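{- (1) There is a focally adequate encoding of (polarised) classical multiplicative additive linear logic, i.e. $\mathrm{CSL}(\mathtt{mall})$, in intuitionistic MALL, i.e. $\mathrm{ISL}(\mathtt{mall})$. (2) There is a focally adequate encoding of (polarised) classical linear logic, i.e. $\mathrm{CSL}(\mathtt{ll})$, in intuitionistic linear logic, i.e. $\mathrm{ISL}(\mathtt{ll})$. (3) There is a focally adequate encoding of (polarised) classical logic, i.e. $\mathrm{CSL}(\mathtt{l})$, in intuitionistic logic, i.e. $\mathrm{ISL}(\mathtt{l})$. The signatures $\mathtt{mall},\mathtt{ll},\mathtt{l}$ and the notions used are defined in the context.
   Context: **Signatures.** A subexponential signature is $\Sigma=\langle Z,\le,\mathsf w,U\rangle$ where $\langle Z,\le\rangle$ is a non-empty preordered set (of "zones"), $\mathsf w\in Z$ is the working zone, and $U\subseteq Z$ (the unrestricted zones) is upward closed: $z_1\le z_2$ and $z_1\in U$ imply $z_2\in U$. Zones in $Z\setminus U$ are restricted. Letters $u$ range over unrestricted zones, $r$ over restricted zones, $x,y,z$ over all zones. Particular signatures (each preorder being the reflexive closure of the listed relations): - $\mathtt{mall}$: $Z=\{\mathsf w\}$, working zone $\mathsf w$, $U=\emptyset$. - $\mathtt{ll}$: $Z=\{\mathsf w,\mathsf u\}$, $\mathsf w\le\mathsf u$, working zone $\mathsf w$, $U=\{\mathsf u\}$. - $\mathtt{l}$: $Z=\{\mathsf w\}$, working zone $\mathsf w$, $U=\{\mathsf w\}$. **Formulas.** Each atom is either positive ($p,q$) or negative ($n,m$). Classical formulas: positive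 $P,Q::=p\mid P\otimes Q\mid 1\mid P\oplus Q\mid 0\mid\ !_z\check N$; negative $N,M::=n\mid N\& M\mid\top\mid N⅋ M\mid\bot\mid P\multimap N\mid\ ?_z\hat P$. Here $z\in Z$, $\hat P$ (or $\hat Q$) denotes a positive formula or a negative atom, and $\check N$ denotes a negative formula or a positive atom. Intuitionistic formulas are the same without $⅋$ and $\bot$. $A$ is an arbitrary formula and $a$ an arbitrary atom. **Contexts.** $\Gamma$ (left passive): elements $z{:}\check N$. $\Delta$ (right passive): elements $z{:}\hat P$. $\Omega$ (left active): elements $\hat P$. $\Xi$ (right active): elements $\check N$. Contexts are finite multisets of occurrences; derivations that act on different occurrences are counted as different. $\Gamma^u,\Delta^u$ denote passive contexts all of whose zones are unrestricted; $\Gamma^r_i,\Delta^r_i$ denote passive contexts all of whose zones are restricted. **Focused calculus $\mathrm{CSL}(\Sigma)$.** Sequents: $\Gamma\vdash[P];\Delta$ (right focus), $\Gamma;[N]\vdash\Delta$ (left focus), $\Gamma;\Omega\vdash\Xi;\Delta$ (active). Rules (premises $\Rightarrow$ conclusion; "$\Rightarrow S$" means no premises): - Right focus: $\Rightarrow\Gamma^u,z{:}p\vdash[p];\Delta^u$ (any $z$). From $\Gamma^u,\Gamma^r_1\vdash[P];\Delta^u,\Delta^r_1$ and $\Gamma^u,\Gamma^r_2\vdash[Q];\Delta^u,\Delta^r_2$ infer $\Gamma^u,\Gamma^r_1,\Gamma^r_2\vdash[P\otimes Q];\Delta^u,\Delta^r_1,\Delta^r_2$. $\Rightarrow\Gamma^u\vdash[1];\Delta^u$.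 $\Gamma\vdash[P_i];\Delta\Rightarrow\Gamma\vdash[P_1\oplus P_2];\Delta$ ($i=1,2$). $\Gamma;\cdot\vdash\check N;\Delta\Rightarrow\Gamma\vdash[!_z\check N];\Delta$ provided $z\le x$ for all $x{:}A$ in $\Gamma,\Delta$. (No rule for $0$.) - Left focus: $\Rightarrow\Gamma^u;[n]\vdash\Delta^u,z{:}n$ (any $z$). $\Gamma;[N_i]\vdash\Delta\Rightarrow\Gamma;[N_1\& N_2]\vdash\Delta$. From $\Gamma^u,\Gamma^r_1;[N]\vdash\Delta^u,\Delta^r_1$ and $\Gamma^u,\Gamma^r_2;[M]\vdash\Delta^u,\Delta^r_2$ infer $\Gamma^u,\Gamma^r_1,\Gamma^r_2;[N⅋ M]\vdash\Delta^u,\Delta^r_1,\Delta^r_2$. $\Rightarrow\Gamma^u;[\bot]\vdash\Delta^u$. From $\Gamma^u,\Gamma^r_1\vdash[P];\Delta^u,\Delta^r_1$ and $\Gamma^u,\Gamma^r_2;[M]\vdash\Delta^u,\Delta^r_2$ infer $\Gamma^u,\Gamma^r_1,\Gamma^r_2;[P\multimap M]\vdash\Delta^u,\Delta^r_1,\Delta^r_2$. $\Gamma;\hat P\vdash\cdot;\Delta\Rightarrow\Gamma;[?_z\hat P]\vdash\Delta$ provided $z\le x$ for all $x{:}A$ in $\Gamma,\Delta$. (No rule for $\top$.) - Right active: $\Gamma;\Omega\vdash\Xi;\Delta,\mathsf w{:}a\Rightarrow\Gamma;\Omega\vdash\Xi,a;\Delta$. $\Gamma;\Omega\vdash\Xi,N;\Delta$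 and $\Gamma;\Omega\vdash\Xi,M;\Delta\Rightarrow\Gamma;\Omega\vdash\Xi,N\& M;\Delta$. $\Rightarrow\Gamma;\Omega\vdash\Xi,\top;\Delta$. $\Gamma;\Omega\vdash\Xi,N,M;\Delta\Rightarrow\Gamma;\Omega\vdash\Xi,N⅋ M;\Delta$. $\Gamma;\Omega\vdash\Xi;\Delta\Rightarrow\Gamma;\Omega\vdash\Xi,\bot;\Delta$. $\Gamma;\Omega,P\vdash\Xi,N;\Delta\Rightarrow\Gamma;\Omega\vdash\Xi,P\multimap N;\Delta$. $\Gamma;\Omega\vdash\Xi;\Delta,z{:}\hat P\Rightarrow\Gamma;\Omega\vdash\Xi,?_z\hat P;\Delta$. - Left active: $\Gamma,\mathsf w{:}a;\Omega\vdash\Xi;\Delta\Rightarrow\Gamma;\Omega,a\vdash\Xi;\Delta$. $\Gamma;\Omega,P,Q\vdash\Xi;\Delta\Rightarrow\Gamma;\Omega,P\otimes Q\vdash\Xi;\Delta$. $\Gamma;\Omega\vdash\Xi;\Delta\Rightarrow\Gamma;\Omega,1\vdash\Xi;\Delta$. $\Gamma;\Omega,P\vdash\Xi;\Delta$ and $\Gamma;\Omega,Q\vdash\Xi;\Delta\Rightarrow\Gamma;\Omega,P\oplus Q\vdash\Xi;\Delta$. $\Rightarrow\Gamma;\Omega,0\vdash\Xi;\Delta$. $\Gamma,z{:}\check N;\Omega\vdash\Xi;\Delta\Rightarrow\Gamma;\Omega,!_z\check N\vdash\Xi;\Delta$. - Decision ($P$ positive, $N$ negative): $\Gamma\vdash[P];\Delta\Rightarrow\Gamma;\cdot\vdash\cdot;\Delta,r{:}P$.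 $\Gamma\vdash[P];\Delta,u{:}P\Rightarrow\Gamma;\cdot\vdash\cdot;\Delta,u{:}P$. $\Gamma;[N]\vdash\Delta\Rightarrow\Gamma,r{:}N;\cdot\vdash\cdot;\Delta$. $\Gamma,u{:}N;[N]\vdash\Delta\Rightarrow\Gamma,u{:}N;\cdot\vdash\cdot;\Delta$. **Focused calculus $\mathrm{ISL}(\Sigma)$.** The restriction of the focused calculus $\mathrm{CSL}(\Sigma)$ to intuitionistic formulas and to exactly one formula on the right. Sequents: $\Gamma\vdash[P]$; $\Gamma;[N]\vdash z{:}\hat Q$; $\Gamma;\Omega\vdash\check N;\cdot$; $\Gamma;\Omega\vdash\cdot;z{:}\hat Q$. Its rules are those of $\mathrm{CSL}(\Sigma)$ for the remaining connectives with right contexts restricted accordingly: in right-focus rules the right passive context is empty (so the side condition of the $!_z$ rule concerns only $\Gamma$); in the left-focus rule for $P\multimap M$ the right formula $z{:}\hat Q$ goes to the premise focused on $M$; the side condition of the $?_z$ left-focus rule concerns $\Gamma$ and the zone of the right formula; the initial left-focus rule is $\Rightarrow\Gamma^u;[n]\vdash z{:}n$; the two right decision rules become the single rule $\Gamma\vdash[P]\Rightarrow\Gamma;\cdot\vdash\cdot;z{:}P$ for every zone $z$, with no copying. **Synthetic derivations.** A neutral sequent is one of the form $\Gamma;\cdot\vdash\cdot;\Delta$ (intuitionistically $\Gamma;\cdot\vdash\cdot;z{:}\hat Q$). A synthetic derivation with conclusion a neutral sequent $S$ is a finite derivation with root $S$ whose last rule is a decision rule, with no other decision rule, and all of whose open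 leaves (its open premises) are neutral sequents. Two synthetic derivations are identified if they differ only in the (inessential) way the active rules are applied, e.g. their order. **Focal adequacy.** An encoding $E$ of a source calculus in a target calculus maps neutral source sequents to neutral target sequents by translating each zoned formula of the sequent separately (the translation depending only on the zoned formula and the side on which it occurs; the result may be placed on either side), possibly together with a fixed additional zoned formula; the target may use additional fresh atoms. $E$ is focally adequate if source and target have the same synthetic inference rules: for every neutral source sequent $S$ there is a bijection between the synthetic derivations with conclusion $S$ and those of the target with conclusion $E(S)$, under which a derivation with open premises $S_1,\dots,S_n$ corresponds to one with open premises $E(S_1),\dots,E(S_n)$. -}

module Defs where

open import Data.Empty using (⊥)
open import Data.List.Base using (List; []; _∷_; [_]; _++_; map; fromMaybe; partitionSums)
open import Data.List.Membership.Propositional using (_∈_)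
open import Data.List.Relation.Binary.Permutation.Propositional using (_↭_; ↭-setoid)
open import Data.List.Relation.Unary.All using (All)
open import Data.List.Relation.Unary.Any using (_─_)
open import Data.Maybe.Base using (Maybe)
open import Data.Product.Base using (Σ; _×_; _,_; proj₁; proj₂; <_,_>)
open import Data.Product.Relation.Binary.Pointwise.NonDependent using (×-setoid)
open import Data.Sum.Base using (_⊎_)
open import Data.Unit.Base using (tt) renaming (⊤ to Unit)
open import Function.Bundles using (Bijection)
open import Level using (0ℓ)
open import Relation.Binary.Bundles using (Setoid)
open import Relation.Binary.Core using (Rel)
open import Relation.Binary.Structures using (IsPreorder)
import Relation.Binary.Construct.Closure.Reflexive as Refl
import Relation.Binary.Construct.Closure.Reflexive.Properties as Reflₚ
import Relation.Binary.Construct.On as On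
open import Relation.Binary.PropositionalEquality using (_≡_; refl; setoid)
open import Relation.Nullary.Negation using (¬_)
open import Relation.Unary using (Pred)

record Signature : Set₁ where
  infix 4 _≤_
  field
    Zone       : Set
    _≤_        : Rel Zone 0ℓ
    isPreorder : IsPreorder _≡_ _≤_
    w          : Zone
    U          : Pred Zone 0ℓ
    U-upward   : ∀ {x y} → x ≤ y → U x → U y

data NoEdge : Rel Unit 0ℓ where

mall : Signature
mall = record
  { Zone       = Unit
  ; _≤_        = Refl.ReflClosure NoEdge
  ; isPreorder = Reflₚ.isPreorder λ ()
  ; w          = tt
  ; U          = λ _ → ⊥
  ; U-upward   = λ _ ()
  }

data Zone-ll : Set where
  𝕨 𝕦 : Zone-ll

data Edge-ll : Rel Zone-ll 0ℓ where
  𝕨≤𝕦 : Edge-ll 𝕨 𝕦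

ll : Signature
ll = record
  { Zone       = Zone-ll
  ; _≤_        = Refl.ReflClosure Edge-ll
  ; isPreorder = Reflₚ.isPreorder λ { 𝕨≤𝕦 () }
  ; w          = 𝕨
  ; U          = λ z → z ≡ 𝕦
  ; U-upward   = λ { Refl.refl z≡𝕦 → z≡𝕦 ; Refl.[ 𝕨≤𝕦 ] () }
  }

l : Signature
l = record
  { Zone       = Unit
  ; _≤_        = Refl.ReflClosure NoEdge
  ; isPreorder = Reflₚ.isPreorder λ ()
  ; w          = tt
  ; U          = λ _ → Unit
  ; U-upward   = λ _ _ → tt
  }

data Mode : Set where
  classical intuitionistic : Mode

module Formulas (Zone A⁺ A⁻ : Set) where

  infixr 7 _⊗_ _&_
  infixr 6 _⊕_ _⅋_
  infixr 5 _⊸_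
  infix  8 ![_]_ ?[_]_

  -- Pos^ consists of the positive formulas and the negative atoms,
  -- Neg^ of the negative formulas and the positive atoms.
  data Pos  : Mode → Set
  data Neg  : Mode → Set
  data Pos^ : Mode → Set
  data Neg^ : Mode → Set

  data Pos where
    atom  : ∀ {m} → A⁺ → Pos m
    _⊗_   : ∀ {m} → Pos m → Pos m → Pos m
    𝟙     : ∀ {m} → Pos m
    _⊕_   : ∀ {m} → Pos m → Pos m → Pos m
    𝟘     : ∀ {m} → Pos m
    ![_]_ : ∀ {m} → Zone → Neg^ m → Pos m

  data Neg where
    atom  : ∀ {m} → A⁻ → Neg m
    _&_   : ∀ {m} → Neg m → Neg m → Neg m
    top   : ∀ {m} → Neg m
    _⅋_   : Neg classical → Neg classical → Neg classical
    bot   : Neg classical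
    _⊸_   : ∀ {m} → Pos m → Neg m → Neg m
    ?[_]_ : ∀ {m} → Zone → Pos^ m → Neg m

  data Pos^ where
    pos   : ∀ {m} → Pos m → Pos^ m
    natom : ∀ {m} → A⁻ → Pos^ m

  data Neg^ where
    neg   : ∀ {m} → Neg m → Neg^ m
    patom : ∀ {m} → A⁺ → Neg^ m

-- Contexts are lists, and rules name the occurrence they act on by a
-- membership proof, so that acting on different occurrences gives
-- different derivations.  Side conditions on zones are irrelevant
-- arguments, so that their proofs do not multiply derivations.

module Passive (𝒮 : Signature) where
  open Signature 𝒮

  Ctx : Set → Set
  Ctx A = List (Zone × A)

  Unr : ∀ {A} → Ctx A → Set
  Unr = All (λ zA → U (proj₁ zA))

  infix 4 _≤*_
  _≤*_ : ∀ {A} → Zone → Ctx A → Set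
  z ≤* Γ = All (λ xA → z ≤ proj₁ xA) Γ

  -- Divides Γᵘ,Γ₁ʳ,Γ₂ʳ into Γᵘ,Γ₁ʳ and Γᵘ,Γ₂ʳ.
  data Split {A : Set} : Ctx A → Ctx A → Ctx A → Set where
    []    : Split [] [] []
    share : ∀ {z B Γ Γ₁ Γ₂} → .(U z) → Split Γ Γ₁ Γ₂ →
            Split ((z , B) ∷ Γ) ((z , B) ∷ Γ₁) ((z , B) ∷ Γ₂)
    fst   : ∀ {z B Γ Γ₁ Γ₂} → .(¬ U z) → Split Γ Γ₁ Γ₂ →
            Split ((z , B) ∷ Γ) ((z , B) ∷ Γ₁) Γ₂
    snd   : ∀ {z B Γ Γ₁ Γ₂} → .(¬ U z) → Split Γ Γ₁ Γ₂ →
            Split ((z , B) ∷ Γ) Γ₁ ((z , B) ∷ Γ₂)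

record Calculus : Set₁ where
  field
    Left Right : Set
    Neutral    : Set
    left       : Neutral → List Left
    right      : Neutral → List Right
    -- the setoid equality is identification up to inessential differences
    Synthetic  : Neutral → Setoid 0ℓ 0ℓ
    premises   : ∀ {S} → Setoid.Carrier (Synthetic S) → List Neutral

  neutralSetoid : Setoid 0ℓ 0ℓ
  neutralSetoid =
    On.setoid (×-setoid (↭-setoid {A = Left}) (↭-setoid {A = Right})) < left , right >

  open import Data.List.Relation.Binary.Permutation.Setoid neutralSetoid public
    using () renaming (_↭_ to _↭ₙ_)

record Encoding (C D : Calculus) : Set where
  private
    module C = Calculus C
    module D = Calculus D
  field
    onLeft  : C.Left  → D.Left ⊎ D.Right
    onRight : C.Right → D.Left ⊎ D.Right
    extra   : Maybe (D.Left ⊎ D.Right)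

  image : C.Neutral → List (D.Left ⊎ D.Right)
  image S = fromMaybe extra ++ map onLeft (C.left S) ++ map onRight (C.right S)

  field
    encode       : C.Neutral → D.Neutral
    encode-left  : ∀ S → D.left  (encode S) ↭ proj₁ (partitionSums (image S))
    encode-right : ∀ S → D.right (encode S) ↭ proj₂ (partitionSums (image S))

FocallyAdequate : ∀ {C D} → Encoding C D → Set
FocallyAdequate {C} {D} E =
  ∀ S → Σ (Bijection (C.Synthetic S) (D.Synthetic (encode S))) λ β →
    ∀ d → D.premises (Bijection.to β d) D.↭ₙ map encode (C.premises d)
  where
  module C = Calculus C
  module D = Calculus D
  open Encoding E

module Classical (𝒮 : Signature) (A⁺ A⁻ : Set) where
  open Signature 𝒮
  open Passive 𝒮
  open Formulas Zone A⁺ A⁻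

  LCtx RCtx : Set
  LCtx = Ctx (Neg^ classical)
  RCtx = Ctx (Pos^ classical)

  infix 3 _⊢_ _⊢[_]_ _[_]⊢_ _⨾_⊢_⨾_

  record Neutral : Set where
    constructor _⊢_
    field
      left  : LCtx
      right : RCtx

  data Focused : Set where
    _⊢[_]_ : LCtx → Pos classical → RCtx → Focused
    _[_]⊢_ : LCtx → Neg classical → RCtx → Focused

  data Active : Set where
    _⨾_⊢_⨾_ : LCtx → List (Pos^ classical) → List (Neg^ classical) → RCtx → Active

  variable
    Γ Γ₁ Γ₂ : LCtx
    Δ Δ₁ Δ₂ : RCtx
    Ω       : List (Pos^ classical)
    Ξ       : List (Neg^ classical)
    P Q     : Pos classical
    N M     : Neg classical
    P^      : Pos^ classical
    N^      : Neg^ classical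
    p       : A⁺
    n       : A⁻
    z       : Zone

  -- Decision-free derivations ending in an active sequent; they consist
  -- of active rules only, and their open leaves are neutral.
  data ActivePhase : Active → Set where
    open-leaf : ActivePhase (Γ ⨾ [] ⊢ [] ⨾ Δ)

    patomR : (i : patom p ∈ Ξ) →
             ActivePhase (Γ ⨾ Ω ⊢ Ξ ─ i ⨾ (w , pos (atom p)) ∷ Δ) →
             ActivePhase (Γ ⨾ Ω ⊢ Ξ ⨾ Δ)
    natomR : (i : neg (atom n) ∈ Ξ) →
             ActivePhase (Γ ⨾ Ω ⊢ Ξ ─ i ⨾ (w , natom n) ∷ Δ) →
             ActivePhase (Γ ⨾ Ω ⊢ Ξ ⨾ Δ)
    &R     : (i : neg (N & M) ∈ Ξ) →
             ActivePhase (Γ ⨾ Ω ⊢ neg N ∷ (Ξ ─ i) ⨾ Δ) →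
             ActivePhase (Γ ⨾ Ω ⊢ neg M ∷ (Ξ ─ i) ⨾ Δ) →
             ActivePhase (Γ ⨾ Ω ⊢ Ξ ⨾ Δ)
    topR   : neg top ∈ Ξ → ActivePhase (Γ ⨾ Ω ⊢ Ξ ⨾ Δ)
    ⅋R     : (i : neg (N ⅋ M) ∈ Ξ) →
             ActivePhase (Γ ⨾ Ω ⊢ neg N ∷ neg M ∷ (Ξ ─ i) ⨾ Δ) →
             ActivePhase (Γ ⨾ Ω ⊢ Ξ ⨾ Δ)
    botR   : (i : neg bot ∈ Ξ) →
             ActivePhase (Γ ⨾ Ω ⊢ Ξ ─ i ⨾ Δ) →
             ActivePhase (Γ ⨾ Ω ⊢ Ξ ⨾ Δ)
    ⊸R     : (i : neg (P ⊸ N) ∈ Ξ) →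
             ActivePhase (Γ ⨾ pos P ∷ Ω ⊢ neg N ∷ (Ξ ─ i) ⨾ Δ) →
             ActivePhase (Γ ⨾ Ω ⊢ Ξ ⨾ Δ)
    ?R     : (i : neg (?[ z ] P^) ∈ Ξ) →
             ActivePhase (Γ ⨾ Ω ⊢ Ξ ─ i ⨾ (z , P^) ∷ Δ) →
             ActivePhase (Γ ⨾ Ω ⊢ Ξ ⨾ Δ)

    patomL : (i : pos (atom p) ∈ Ω) →
             ActivePhase ((w , patom p) ∷ Γ ⨾ Ω ─ i ⊢ Ξ ⨾ Δ) →
             ActivePhase (Γ ⨾ Ω ⊢ Ξ ⨾ Δ)
    natomL : (i : natom n ∈ Ω) →
             ActivePhase ((w , neg (atom n)) ∷ Γ ⨾ Ω ─ i ⊢ Ξ ⨾ Δ) →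
             ActivePhase (Γ ⨾ Ω ⊢ Ξ ⨾ Δ)
    ⊗L     : (i : pos (P ⊗ Q) ∈ Ω) →
             ActivePhase (Γ ⨾ pos P ∷ pos Q ∷ (Ω ─ i) ⊢ Ξ ⨾ Δ) →
             ActivePhase (Γ ⨾ Ω ⊢ Ξ ⨾ Δ)
    𝟙L     : (i : pos 𝟙 ∈ Ω) →
             ActivePhase (Γ ⨾ Ω ─ i ⊢ Ξ ⨾ Δ) →
             ActivePhase (Γ ⨾ Ω ⊢ Ξ ⨾ Δ)
    ⊕L     : (i : pos (P ⊕ Q) ∈ Ω) →
             ActivePhase (Γ ⨾ pos P ∷ (Ω ─ i) ⊢ Ξ ⨾ Δ) →
             ActivePhase (Γ ⨾ pos Q ∷ (Ω ─ i) ⊢ Ξ ⨾ Δ) →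
             ActivePhase (Γ ⨾ Ω ⊢ Ξ ⨾ Δ)
    𝟘L     : pos 𝟘 ∈ Ω → ActivePhase (Γ ⨾ Ω ⊢ Ξ ⨾ Δ)
    !L     : (i : pos (![ z ] N^) ∈ Ω) →
             ActivePhase ((z , N^) ∷ Γ ⨾ Ω ─ i ⊢ Ξ ⨾ Δ) →
             ActivePhase (Γ ⨾ Ω ⊢ Ξ ⨾ Δ)

  -- X S is what is recorded above an active sequent S.
  data FocusPhase (X : Active → Set) : Focused → Set where
    initR : (i : (z , patom p) ∈ Γ) → .(Unr (Γ ─ i)) → .(Unr Δ) →
            FocusPhase X (Γ ⊢[ atom p ] Δ)
    ⊗R    : Split Γ Γ₁ Γ₂ → Split Δ Δ₁ Δ₂ →
            FocusPhase X (Γ₁ ⊢[ P ] Δ₁) → FocusPhase X (Γ₂ ⊢[ Q ] Δ₂) →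
            FocusPhase X (Γ ⊢[ P ⊗ Q ] Δ)
    𝟙R    : .(Unr Γ) → .(Unr Δ) → FocusPhase X (Γ ⊢[ 𝟙 ] Δ)
    ⊕R₁   : FocusPhase X (Γ ⊢[ P ] Δ) → FocusPhase X (Γ ⊢[ P ⊕ Q ] Δ)
    ⊕R₂   : FocusPhase X (Γ ⊢[ Q ] Δ) → FocusPhase X (Γ ⊢[ P ⊕ Q ] Δ)
    !R    : .(z ≤* Γ) → .(z ≤* Δ) → X (Γ ⨾ [] ⊢ [ N^ ] ⨾ Δ) →
            FocusPhase X (Γ ⊢[ ![ z ] N^ ] Δ)

    initL : (i : (z , natom n) ∈ Δ) → .(Unr Γ) → .(Unr (Δ ─ i)) →
            FocusPhase X (Γ [ atom n ]⊢ Δ)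
    &L₁   : FocusPhase X (Γ [ N ]⊢ Δ) → FocusPhase X (Γ [ N & M ]⊢ Δ)
    &L₂   : FocusPhase X (Γ [ M ]⊢ Δ) → FocusPhase X (Γ [ N & M ]⊢ Δ)
    ⅋L    : Split Γ Γ₁ Γ₂ → Split Δ Δ₁ Δ₂ →
            FocusPhase X (Γ₁ [ N ]⊢ Δ₁) → FocusPhase X (Γ₂ [ M ]⊢ Δ₂) →
            FocusPhase X (Γ [ N ⅋ M ]⊢ Δ)
    botL  : .(Unr Γ) → .(Unr Δ) → FocusPhase X (Γ [ bot ]⊢ Δ)
    ⊸L    : Split Γ Γ₁ Γ₂ → Split Δ Δ₁ Δ₂ →
            FocusPhase X (Γ₁ ⊢[ P ] Δ₁) → FocusPhase X (Γ₂ [ M ]⊢ Δ₂) →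
            FocusPhase X (Γ [ P ⊸ M ]⊢ Δ)
    ?L    : .(z ≤* Γ) → .(z ≤* Δ) → X (Γ ⨾ [ P^ ] ⊢ [] ⨾ Δ) →
            FocusPhase X (Γ [ ?[ z ] P^ ]⊢ Δ)

  data Decision (X : Active → Set) : Neutral → Set where
    decideRʳ : (i : (z , pos P) ∈ Δ) → .(¬ U z) →
               FocusPhase X (Γ ⊢[ P ] (Δ ─ i)) → Decision X (Γ ⊢ Δ)
    decideRᵘ : (z , pos P) ∈ Δ → .(U z) →
               FocusPhase X (Γ ⊢[ P ] Δ) → Decision X (Γ ⊢ Δ)
    decideLʳ : (i : (z , neg N) ∈ Γ) → .(¬ U z) →
               FocusPhase X ((Γ ─ i) [ N ]⊢ Δ) → Decision X (Γ ⊢ Δ)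
    decideLᵘ : (z , neg N) ∈ Γ → .(U z) →
               FocusPhase X (Γ [ N ]⊢ Δ) → Decision X (Γ ⊢ Δ)

  SyntheticDerivation : Neutral → Set
  SyntheticDerivation = Decision ActivePhase

  leaves : ∀ {S} → ActivePhase S → List Neutral
  leaves (open-leaf {Γ} {Δ}) = [ Γ ⊢ Δ ]
  leaves (patomR _ d)        = leaves d
  leaves (natomR _ d)        = leaves d
  leaves (&R _ d e)          = leaves d ++ leaves e
  leaves (topR _)            = []
  leaves (⅋R _ d)            = leaves d
  leaves (botR _ d)          = leaves d
  leaves (⊸R _ d)            = leaves d
  leaves (?R _ d)            = leaves d
  leaves (patomL _ d)        = leaves d
  leaves (natomL _ d)        = leaves d
  leaves (⊗L _ d)            = leaves d
  leaves (𝟙L _ d)            = leaves d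
  leaves (⊕L _ d e)          = leaves d ++ leaves e
  leaves (𝟘L _)              = []
  leaves (!L _ d)            = leaves d

  focusLeaves : ∀ {S} → FocusPhase ActivePhase S → List Neutral
  focusLeaves (initR _ _ _)  = []
  focusLeaves (⊗R _ _ d e)   = focusLeaves d ++ focusLeaves e
  focusLeaves (𝟙R _ _)       = []
  focusLeaves (⊕R₁ d)        = focusLeaves d
  focusLeaves (⊕R₂ d)        = focusLeaves d
  focusLeaves (!R _ _ d)     = leaves d
  focusLeaves (initL _ _ _)  = []
  focusLeaves (&L₁ d)        = focusLeaves d
  focusLeaves (&L₂ d)        = focusLeaves d
  focusLeaves (⅋L _ _ d e)   = focusLeaves d ++ focusLeaves e
  focusLeaves (botL _ _)     = []
  focusLeaves (⊸L _ _ d e)   = focusLeaves d ++ focusLeaves e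
  focusLeaves (?L _ _ d)     = leaves d

  premises : ∀ {S} → SyntheticDerivation S → List Neutral
  premises (decideRʳ _ _ d) = focusLeaves d
  premises (decideRᵘ _ _ d) = focusLeaves d
  premises (decideLʳ _ _ d) = focusLeaves d
  premises (decideLᵘ _ _ d) = focusLeaves d

  Erased : Active → Set
  Erased _ = Unit

  eraseFocus : ∀ {S} → FocusPhase ActivePhase S → FocusPhase Erased S
  eraseFocus (initR i a b) = initR i a b
  eraseFocus (⊗R s t d e)  = ⊗R s t (eraseFocus d) (eraseFocus e)
  eraseFocus (𝟙R a b)      = 𝟙R a b
  eraseFocus (⊕R₁ d)       = ⊕R₁ (eraseFocus d)
  eraseFocus (⊕R₂ d)       = ⊕R₂ (eraseFocus d)
  eraseFocus (!R a b _)    = !R a b tt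
  eraseFocus (initL i a b) = initL i a b
  eraseFocus (&L₁ d)       = &L₁ (eraseFocus d)
  eraseFocus (&L₂ d)       = &L₂ (eraseFocus d)
  eraseFocus (⅋L s t d e)  = ⅋L s t (eraseFocus d) (eraseFocus e)
  eraseFocus (botL a b)    = botL a b
  eraseFocus (⊸L s t d e)  = ⊸L s t (eraseFocus d) (eraseFocus e)
  eraseFocus (?L a b _)    = ?L a b tt

  erase : ∀ {S} → SyntheticDerivation S → Decision Erased S
  erase (decideRʳ i a d) = decideRʳ i a (eraseFocus d)
  erase (decideRᵘ i a d) = decideRᵘ i a (eraseFocus d)
  erase (decideLʳ i a d) = decideLʳ i a (eraseFocus d)
  erase (decideLᵘ i a d) = decideLᵘ i a (eraseFocus d)

  -- Two synthetic derivations are identified when they differ only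
  -- inside their active phases, that is, only in the way active rules
  -- are applied above the same active sequents.
  calculus : Calculus
  calculus = record
    { Left      = Zone × Neg^ classical
    ; Right     = Zone × Pos^ classical
    ; Neutral   = Neutral
    ; left      = Neutral.left
    ; right     = Neutral.right
    ; Synthetic = λ S → On.setoid (setoid (Decision Erased S)) erase
    ; premises  = premises
    }

module Intuitionistic (𝒮 : Signature) (A⁺ A⁻ : Set) where
  open Signature 𝒮
  open Passive 𝒮
  open Formulas Zone A⁺ A⁻

  LCtx RFormula : Set
  LCtx     = Ctx (Neg^ intuitionistic)
  RFormula = Zone × Pos^ intuitionistic

  infix 3 _⊢_ _⊢[_] _[_]⊢_ _⨾_⊢_

  record Neutral : Set where
    constructor _⊢_
    field
      left  : LCtx
      right : RFormula

  data Focused : Set where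
    _⊢[_]  : LCtx → Pos intuitionistic → Focused
    _[_]⊢_ : LCtx → Neg intuitionistic → RFormula → Focused

  data Goal : Set where
    active  : Neg^ intuitionistic → Goal
    passive : RFormula → Goal

  data Active : Set where
    _⨾_⊢_ : LCtx → List (Pos^ intuitionistic) → Goal → Active

  variable
    Γ Γ₁ Γ₂ : LCtx
    R       : RFormula
    Ω       : List (Pos^ intuitionistic)
    G       : Goal
    P Q     : Pos intuitionistic
    N M     : Neg intuitionistic
    P^      : Pos^ intuitionistic
    N^      : Neg^ intuitionistic
    p       : A⁺
    n       : A⁻
    z       : Zone

  data ActivePhase : Active → Set where
    open-leaf : ActivePhase (Γ ⨾ [] ⊢ passive R)

    patomR : ActivePhase (Γ ⨾ Ω ⊢ passive (w , pos (atom p))) →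
             ActivePhase (Γ ⨾ Ω ⊢ active (patom p))
    natomR : ActivePhase (Γ ⨾ Ω ⊢ passive (w , natom n)) →
             ActivePhase (Γ ⨾ Ω ⊢ active (neg (atom n)))
    &R     : ActivePhase (Γ ⨾ Ω ⊢ active (neg N)) →
             ActivePhase (Γ ⨾ Ω ⊢ active (neg M)) →
             ActivePhase (Γ ⨾ Ω ⊢ active (neg (N & M)))
    topR   : ActivePhase (Γ ⨾ Ω ⊢ active (neg top))
    ⊸R     : ActivePhase (Γ ⨾ pos P ∷ Ω ⊢ active (neg N)) →
             ActivePhase (Γ ⨾ Ω ⊢ active (neg (P ⊸ N)))
    ?R     : ActivePhase (Γ ⨾ Ω ⊢ passive (z , P^)) →
             ActivePhase (Γ ⨾ Ω ⊢ active (neg (?[ z ] P^)))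

    patomL : (i : pos (atom p) ∈ Ω) →
             ActivePhase ((w , patom p) ∷ Γ ⨾ Ω ─ i ⊢ G) →
             ActivePhase (Γ ⨾ Ω ⊢ G)
    natomL : (i : natom n ∈ Ω) →
             ActivePhase ((w , neg (atom n)) ∷ Γ ⨾ Ω ─ i ⊢ G) →
             ActivePhase (Γ ⨾ Ω ⊢ G)
    ⊗L     : (i : pos (P ⊗ Q) ∈ Ω) →
             ActivePhase (Γ ⨾ pos P ∷ pos Q ∷ (Ω ─ i) ⊢ G) →
             ActivePhase (Γ ⨾ Ω ⊢ G)
    𝟙L     : (i : pos 𝟙 ∈ Ω) →
             ActivePhase (Γ ⨾ Ω ─ i ⊢ G) →
             ActivePhase (Γ ⨾ Ω ⊢ G)
    ⊕L     : (i : pos (P ⊕ Q) ∈ Ω) →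
             ActivePhase (Γ ⨾ pos P ∷ (Ω ─ i) ⊢ G) →
             ActivePhase (Γ ⨾ pos Q ∷ (Ω ─ i) ⊢ G) →
             ActivePhase (Γ ⨾ Ω ⊢ G)
    𝟘L     : pos 𝟘 ∈ Ω → ActivePhase (Γ ⨾ Ω ⊢ G)
    !L     : (i : pos (![ z ] N^) ∈ Ω) →
             ActivePhase ((z , N^) ∷ Γ ⨾ Ω ─ i ⊢ G) →
             ActivePhase (Γ ⨾ Ω ⊢ G)

  data FocusPhase (X : Active → Set) : Focused → Set where
    initR : (i : (z , patom p) ∈ Γ) → .(Unr (Γ ─ i)) →
            FocusPhase X (Γ ⊢[ atom p ])
    ⊗R    : Split Γ Γ₁ Γ₂ →
            FocusPhase X (Γ₁ ⊢[ P ]) → FocusPhase X (Γ₂ ⊢[ Q ]) →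
            FocusPhase X (Γ ⊢[ P ⊗ Q ])
    𝟙R    : .(Unr Γ) → FocusPhase X (Γ ⊢[ 𝟙 ])
    ⊕R₁   : FocusPhase X (Γ ⊢[ P ]) → FocusPhase X (Γ ⊢[ P ⊕ Q ])
    ⊕R₂   : FocusPhase X (Γ ⊢[ Q ]) → FocusPhase X (Γ ⊢[ P ⊕ Q ])
    !R    : .(z ≤* Γ) → X (Γ ⨾ [] ⊢ active N^) →
            FocusPhase X (Γ ⊢[ ![ z ] N^ ])

    initL : .(Unr Γ) → FocusPhase X (Γ [ atom n ]⊢ (z , natom n))
    &L₁   : FocusPhase X (Γ [ N ]⊢ R) → FocusPhase X (Γ [ N & M ]⊢ R)
    &L₂   : FocusPhase X (Γ [ M ]⊢ R) → FocusPhase X (Γ [ N & M ]⊢ R)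
    ⊸L    : Split Γ Γ₁ Γ₂ →
            FocusPhase X (Γ₁ ⊢[ P ]) → FocusPhase X (Γ₂ [ M ]⊢ R) →
            FocusPhase X (Γ [ P ⊸ M ]⊢ R)
    ?L    : .(z ≤* Γ) → .(z ≤ proj₁ R) → X (Γ ⨾ [ P^ ] ⊢ passive R) →
            FocusPhase X (Γ [ ?[ z ] P^ ]⊢ R)

  data Decision (X : Active → Set) : Neutral → Set where
    decideR  : FocusPhase X (Γ ⊢[ P ]) → Decision X (Γ ⊢ (z , pos P))
    decideLʳ : (i : (z , neg N) ∈ Γ) → .(¬ U z) →
               FocusPhase X ((Γ ─ i) [ N ]⊢ R) → Decision X (Γ ⊢ R)
    decideLᵘ : (z , neg N) ∈ Γ → .(U z) →
               FocusPhase X (Γ [ N ]⊢ R) → Decision X (Γ ⊢ R)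

  SyntheticDerivation : Neutral → Set
  SyntheticDerivation = Decision ActivePhase

  leaves : ∀ {S} → ActivePhase S → List Neutral
  leaves (open-leaf {Γ} {R}) = [ Γ ⊢ R ]
  leaves (patomR d)          = leaves d
  leaves (natomR d)          = leaves d
  leaves (&R d e)            = leaves d ++ leaves e
  leaves topR                = []
  leaves (⊸R d)              = leaves d
  leaves (?R d)              = leaves d
  leaves (patomL _ d)        = leaves d
  leaves (natomL _ d)        = leaves d
  leaves (⊗L _ d)            = leaves d
  leaves (𝟙L _ d)            = leaves d
  leaves (⊕L _ d e)          = leaves d ++ leaves e
  leaves (𝟘L _)              = []
  leaves (!L _ d)            = leaves d

  focusLeaves : ∀ {S} → FocusPhase ActivePhase S → List Neutral
  focusLeaves (initR _ _)  = []
  focusLeaves (⊗R _ d e)   = focusLeaves d ++ focusLeaves e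
  focusLeaves (𝟙R _)       = []
  focusLeaves (⊕R₁ d)      = focusLeaves d
  focusLeaves (⊕R₂ d)      = focusLeaves d
  focusLeaves (!R _ d)     = leaves d
  focusLeaves (initL _)    = []
  focusLeaves (&L₁ d)      = focusLeaves d
  focusLeaves (&L₂ d)      = focusLeaves d
  focusLeaves (⊸L _ d e)   = focusLeaves d ++ focusLeaves e
  focusLeaves (?L _ _ d)   = leaves d

  premises : ∀ {S} → SyntheticDerivation S → List Neutral
  premises (decideR d)      = focusLeaves d
  premises (decideLʳ _ _ d) = focusLeaves d
  premises (decideLᵘ _ _ d) = focusLeaves d

  Erased : Active → Set
  Erased _ = Unit

  eraseFocus : ∀ {S} → FocusPhase ActivePhase S → FocusPhase Erased S
  eraseFocus (initR i a)  = initR i a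
  eraseFocus (⊗R s d e)   = ⊗R s (eraseFocus d) (eraseFocus e)
  eraseFocus (𝟙R a)       = 𝟙R a
  eraseFocus (⊕R₁ d)      = ⊕R₁ (eraseFocus d)
  eraseFocus (⊕R₂ d)      = ⊕R₂ (eraseFocus d)
  eraseFocus (!R a _)     = !R a tt
  eraseFocus (initL a)    = initL a
  eraseFocus (&L₁ d)      = &L₁ (eraseFocus d)
  eraseFocus (&L₂ d)      = &L₂ (eraseFocus d)
  eraseFocus (⊸L s d e)   = ⊸L s (eraseFocus d) (eraseFocus e)
  eraseFocus (?L a b _)   = ?L a b tt

  erase : ∀ {S} → SyntheticDerivation S → Decision Erased S
  erase (decideR d)      = decideR (eraseFocus d)
  erase (decideLʳ i a d) = decideLʳ i a (eraseFocus d)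
  erase (decideLᵘ i a d) = decideLᵘ i a (eraseFocus d)

  calculus : Calculus
  calculus = record
    { Left      = Zone × Neg^ intuitionistic
    ; Right     = RFormula
    ; Neutral   = Neutral
    ; left      = Neutral.left
    ; right     = λ S → [ Neutral.right S ]
    ; Synthetic = λ S → On.setoid (setoid (Decision Erased S)) erase
    ; premises  = premises
    }

CSL ISL : Signature → Set → Set → Calculus
CSL = Classical.calculus
ISL = Intuitionistic.calculus

{-# OPTIONS --safe #-}
module Submission where

-- Zones are kept, and Γ ⊢ Δ becomes Γ′, ¬Δ′ ⊢ k for a fresh negative atom k
-- in the working zone, where ¬P = P ⊸ k.  Deciding on P ⊸ k closes the premise
-- for k at once and leaves a right focus on P.  Left focus on N becomes right
-- focus on the De Morgan dual of N, in which negative atoms turn positive, and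
-- right active formulas likewise become left active ones.  Focused and active
-- occurrences are translated differently, so that each classical phase is one
-- intuitionistic phase.  Only decidability of unrestrictedness is needed: it
-- determines the context that the premise for k has to take.

open import Defs
open import Data.Empty using (⊥-elim-irr)
open import Data.List.Base using (List; []; _∷_; [_]; _++_; map; filter; partitionSums)
open import Data.List.Membership.Propositional using (_∈_)
open import Data.List.Properties using (map-++; ++-identityʳ)
open import Data.List.Relation.Binary.Permutation.Propositional
  using (_↭_; prep; ↭-refl; ↭-sym; ↭-trans; ↭-reflexive)
open import Data.List.Relation.Binary.Permutation.Propositional.Properties
  using (∈-resp-↭; drop-∷; shift; map⁺; ++⁺ˡ; ++⁺ʳ; ↭-empty-inv)
import Data.List.Relation.Binary.Permutation.Setoid as SetoidPermutation
import Data.List.Relation.Binary.Permutation.Setoid.Properties as SetoidPermutationₚ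
open import Data.List.Relation.Unary.All as All using (All; []; _∷_)
open import Data.List.Relation.Unary.All.Properties using (all-filter)
open import Data.List.Relation.Unary.Any using (here; there; _─_)
open import Data.Maybe.Base using (just)
open import Data.Product.Base using (Σ; ∃; _×_; _,_; proj₁; proj₂; map₁; map₂)
open import Data.Sum.Base using (_⊎_; inj₁; inj₂)
open import Data.Unit.Base using (⊤; tt)
open import Function.Base using (_∘_)
open import Function.Bundles using (Bijection)
open import Relation.Binary.PropositionalEquality
  using (_≡_; refl; sym; trans; cong; cong₂; subst)
open import Relation.Nullary.Decidable using (yes; no)
open import Relation.Unary using (Decidable)

-- Removing occurrences up to permutation.

extract : ∀ {A : Set} {x : A} {xs} (i : x ∈ xs) → xs ↭ x ∷ (xs ─ i)
extract (here refl)            = ↭-refl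
extract {xs = y ∷ _} (there i) = ↭-trans (prep y (extract i)) (shift _ [ y ] _)

-- Any occurrence of `x` will do: the choice is made only inside active phases, and these are erased
-- when derivations are compared.
extract-↭ : ∀ {A : Set} {x : A} {xs ys} → xs ↭ x ∷ ys → Σ (x ∈ xs) λ i → (xs ─ i) ↭ ys
extract-↭ ρ = i , drop-∷ (↭-trans (↭-sym (extract i)) ρ)
  where i = ∈-resp-↭ (↭-sym ρ) (here refl)

partitionSums-inj₁ : ∀ {A B C D : Set} (f : A → C) (g : B → C) xs ys →
  partitionSums {B = D} (map (inj₁ ∘ f) xs ++ map (inj₁ ∘ g) ys) ≡ (map f xs ++ map g ys , [])
partitionSums-inj₁ f g []       []       = refl
partitionSums-inj₁ f g []       (y ∷ ys) = cong (map₁ (g y ∷_)) (partitionSums-inj₁ f g [] ys)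
partitionSums-inj₁ f g (x ∷ xs) ys       = cong (map₁ (f x ∷_)) (partitionSums-inj₁ f g xs ys)

-- Splits with an unrestricted second half.

module _ (𝒮 : Signature) where
  open Passive 𝒮

  -- Equality of splits whose halves may differ a priori: matching on `same` identifies the halves
  -- together with the splits.
  data SameSplit {A} {Γ : Ctx A} :
    ∀ {Γ₁ Γ₂ Γ₁′ Γ₂′} → Split Γ Γ₁ Γ₂ → Split Γ Γ₁′ Γ₂′ → Set where
    same : ∀ {Γ₁ Γ₂} {s : Split Γ Γ₁ Γ₂} → SameSplit s s

  -- The zone of each formula leaves no choice: an unrestricted formula must be shared, and a
  -- restricted one cannot go to an unrestricted second half. The zone conditions are irrelevant and
  -- so cannot differ.
  same-split : ∀ {A} {Γ Γ₁ Γ₂ Γ₁′ Γ₂′ : Ctx A} (s : Split Γ Γ₁ Γ₂) (t : Split Γ Γ₁′ Γ₂′) →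
               .(Unr Γ₂) → .(Unr Γ₂′) → SameSplit s t
  same-split []          []          _ _ = same
  same-split (share _ s) (share _ t) a b
    with same ← same-split s t (All.tail a) (All.tail b) = same
  same-split (share u _) (fst ¬u _)  _ _ = ⊥-elim-irr (¬u u)
  same-split (share u _) (snd ¬u _)  _ _ = ⊥-elim-irr (¬u u)
  same-split (fst ¬u _)  (share u _) _ _ = ⊥-elim-irr (¬u u)
  same-split (fst _ s)   (fst _ t)   a b with same ← same-split s t a b = same
  same-split (fst _ _)   (snd ¬u _)  _ b = ⊥-elim-irr (¬u (All.head b))
  same-split (snd ¬u _)  _           a _ = ⊥-elim-irr (¬u (All.head a))

-- Translation of formulas and sequents.

module DoubleNegation
  (𝒮 : Signature) (U? : Decidable (Signature.U 𝒮)) (A⁺ A⁻ : Set) where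

  open Signature 𝒮
  open Passive 𝒮

  -- A negative atom n becomes the positive atom inj₂ n, and inj₂ tt is
  -- the atom k with respect to which formulas are negated.
  B⁺ B⁻ : Set
  B⁺ = A⁺ ⊎ A⁻
  B⁻ = A⁻ ⊎ ⊤

  open Formulas hiding (Pos; Neg; Pos^; Neg^)
  module C = Classical 𝒮 A⁺ A⁻
  module I = Intuitionistic 𝒮 B⁺ B⁻
  open C using (_⊢[_]_; _[_]⊢_; _⨾_⊢_⨾_)
  open I using (_⊢[_]; _[_]⊢_; _⨾_⊢_; active; passive)

  Posᶜ Negᶜ Pos^ᶜ Neg^ᶜ Posⁱ Pos^ⁱ Neg^ⁱ : Set
  Posᶜ  = Formulas.Pos  Zone A⁺ A⁻ classical
  Negᶜ  = Formulas.Neg  Zone A⁺ A⁻ classical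
  Pos^ᶜ = Formulas.Pos^ Zone A⁺ A⁻ classical
  Neg^ᶜ = Formulas.Neg^ Zone A⁺ A⁻ classical
  Posⁱ  = Formulas.Pos  Zone B⁺ B⁻ intuitionistic
  Pos^ⁱ = Formulas.Pos^ Zone B⁺ B⁻ intuitionistic
  Neg^ⁱ = Formulas.Neg^ Zone B⁺ B⁻ intuitionistic

  variable
    Γ Γ₁ Γ₂ : C.LCtx
    Δ Δ₁ Δ₂ : C.RCtx
    Θ Θ₁ Θ₂ Θ₁′ Θ₂′ : I.LCtx
    Ω : List Pos^ᶜ
    Ξ : List Neg^ᶜ
    Φ : List Pos^ⁱ
    P : Posᶜ
    N : Negᶜ
    N^ : Neg^ᶜ
    P^ : Pos^ᶜ
    R : Posⁱ
    p : A⁺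
    n : A⁻
    z : Zone

  negation : Posⁱ → Neg^ⁱ
  negation R = neg (R ⊸ atom (inj₂ tt))

  -- In lactive and ractive, ![ w ] imitates the active rules for atoms, which
  -- move an atom to the working zone, where a negated atom must be stored.
  rfocus   : Posᶜ → Posⁱ
  lfocus   : Negᶜ → Posⁱ
  lactive⁺ : Posᶜ → Posⁱ
  lactive  : Pos^ᶜ → Posⁱ
  ractive⁻ : Negᶜ → Posⁱ
  ractive  : Neg^ᶜ → Posⁱ
  lpassive : Neg^ᶜ → Neg^ⁱ
  rpassive : Pos^ᶜ → Neg^ⁱ

  rfocus (atom p)   = atom (inj₁ p)
  rfocus (P ⊗ Q)    = rfocus P ⊗ rfocus Q
  rfocus 𝟙          = 𝟙
  rfocus (P ⊕ Q)    = rfocus P ⊕ rfocus Q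
  rfocus 𝟘          = 𝟘
  -- After `!R`, the rules `⊸R` and `natomR` make `ractive N` left active and return k to the right,
  -- which is the start of the translated active phase.
  rfocus (![ z ] N) = ![ z ] negation (ractive N)

  lfocus (atom n)   = atom (inj₂ n)
  lfocus (N & M)    = lfocus N ⊕ lfocus M
  lfocus top        = 𝟘
  lfocus (N ⅋ M)    = lfocus N ⊗ lfocus M
  lfocus bot        = 𝟙
  lfocus (P ⊸ N)    = rfocus P ⊗ lfocus N
  lfocus (?[ z ] P) = ![ z ] negation (lactive P)

  lactive⁺ (atom p)   = atom (inj₁ p)
  lactive⁺ (P ⊗ Q)    = lactive⁺ P ⊗ lactive⁺ Q
  lactive⁺ 𝟙          = 𝟙
  lactive⁺ (P ⊕ Q)    = lactive⁺ P ⊕ lactive⁺ Q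
  lactive⁺ 𝟘          = 𝟘
  lactive⁺ (![ z ] N) = ![ z ] lpassive N

  lactive (pos P)   = lactive⁺ P
  lactive (natom n) = ![ w ] negation (atom (inj₂ n))

  ractive⁻ (atom n)   = atom (inj₂ n)
  ractive⁻ (N & M)    = ractive⁻ N ⊕ ractive⁻ M
  ractive⁻ top        = 𝟘
  ractive⁻ (N ⅋ M)    = ractive⁻ N ⊗ ractive⁻ M
  ractive⁻ bot        = 𝟙
  ractive⁻ (P ⊸ N)    = lactive⁺ P ⊗ ractive⁻ N
  ractive⁻ (?[ z ] P) = ![ z ] rpassive P

  ractive (neg N)   = ractive⁻ N
  ractive (patom p) = ![ w ] negation (atom (inj₁ p))

  lpassive (neg N)   = negation (lfocus N)
  lpassive (patom p) = patom (inj₁ p)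

  rpassive (pos P)   = negation (rfocus P)
  rpassive (natom n) = patom (inj₂ n)

  -- The zone is `w` because `natomR` puts k there; thus all encoded premises have the same right
  -- formula.
  goal : I.RFormula
  goal = w , natom (inj₂ tt)

  join : C.LCtx → C.RCtx → I.LCtx
  join Γ Δ = map (map₂ lpassive) Γ ++ map (map₂ rpassive) Δ

  encode : C.Neutral → I.Neutral
  encode (Γ C.⊢ Δ) = join Γ Δ I.⊢ goal

  -- Zones and occurrences in a joined context.

  module _ {T : Zone → Set} where
    -- Taking `T` to be `U` gives `Unr`, and taking it to be `z ≤_` gives `z ≤*_`, so both kinds of
    -- side condition are transferred at once.
    Zones : ∀ {A} → Ctx A → Set
    Zones = All (λ zA → T (proj₁ zA))

    join⁺ : Zones Γ → Zones Δ → Zones (join Γ Δ)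
    join⁺ []       []       = []
    join⁺ []       (b ∷ bs) = b ∷ join⁺ [] bs
    join⁺ (a ∷ as) bs       = a ∷ join⁺ as bs

    joinˡ⁻ : ∀ Γ → Zones (join Γ Δ) → Zones Γ
    joinˡ⁻ []      _        = []
    joinˡ⁻ (_ ∷ Γ) (a ∷ as) = a ∷ joinˡ⁻ Γ as

    joinʳ⁻ : ∀ Γ Δ → Zones (join Γ Δ) → Zones Δ
    joinʳ⁻ []      []      _        = []
    joinʳ⁻ []      (_ ∷ Δ) (a ∷ as) = a ∷ joinʳ⁻ [] Δ as
    joinʳ⁻ (_ ∷ Γ) Δ       (_ ∷ as) = joinʳ⁻ Γ Δ as

  inˡ : (z , N^) ∈ Γ → (z , lpassive N^) ∈ join Γ Δ
  inˡ (here refl) = here refl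
  inˡ (there i)   = there (inˡ i)

  inʳ : ∀ Γ → (z , P^) ∈ Δ → (z , rpassive P^) ∈ join Γ Δ
  inʳ []      (here refl) = here refl
  inʳ []      (there i)   = there (inʳ [] i)
  inʳ (_ ∷ Γ) i           = there (inʳ Γ i)

  ─-inˡ : (i : (z , N^) ∈ Γ) → (join Γ Δ ─ inˡ {Δ = Δ} i) ≡ join (Γ ─ i) Δ
  ─-inˡ (here refl) = refl
  ─-inˡ (there i)   = cong (_ ∷_) (─-inˡ i)

  ─-inʳ : ∀ Γ (i : (z , P^) ∈ Δ) → (join Γ Δ ─ inʳ Γ i) ≡ join Γ (Δ ─ i)
  ─-inʳ []      (here refl) = refl
  ─-inʳ []      (there i)   = cong (_ ∷_) (─-inʳ [] i)
  ─-inʳ (_ ∷ Γ) i           = cong (_ ∷_) (─-inʳ Γ i)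

  -- The tag of an atom reveals its side: `rpassive` yields only negations and `inj₂` atoms, so an
  -- `inj₁` atom stems from `Γ`. Matching on this view turns the occurrence into an `inˡ j`.
  data Patom∈ Γ Δ {z p} : (z , patom (inj₁ p)) ∈ join Γ Δ → Set where
    onˡ : (i : (z , patom p) ∈ Γ) → Patom∈ Γ Δ (inˡ i)

  patom∈ : ∀ Γ Δ {z p} (i : (z , patom (inj₁ p)) ∈ join Γ Δ) → Patom∈ Γ Δ i
  patom∈ []                  ((_ , pos _) ∷ _)   (here ())
  patom∈ []                  ((_ , natom _) ∷ _) (here ())
  patom∈ []                  (_ ∷ Δ)             (there i) with patom∈ [] Δ i
  ... | onˡ ()
  patom∈ (_ ∷ Γ)             Δ                   (there i) with onˡ j ← patom∈ Γ Δ i = onˡ (there j)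
  patom∈ ((_ , neg _) ∷ _)   _                   (here ())
  patom∈ ((_ , patom _) ∷ _) _                   (here refl) = onˡ (here refl)

  -- Rewriting with this, and with its analogues below, lets the backward translation reduce on the
  -- result of the forward one.
  patom∈-inˡ : (i : (z , patom p) ∈ Γ) → patom∈ Γ Δ (inˡ i) ≡ onˡ i
  patom∈-inˡ         (here refl) = refl
  patom∈-inˡ {Δ = Δ} (there i)   rewrite patom∈-inˡ {Δ = Δ} i = refl

  data Natom∈ Γ Δ {z n} : (z , patom (inj₂ n)) ∈ join Γ Δ → Set where
    onʳ : (i : (z , natom n) ∈ Δ) → Natom∈ Γ Δ (inʳ Γ i)

  natom∈ : ∀ Γ Δ {z n} (i : (z , patom (inj₂ n)) ∈ join Γ Δ) → Natom∈ Γ Δ i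
  natom∈ []                  (_ ∷ Δ)             (there i) with onʳ j ← natom∈ [] Δ i = onʳ (there j)
  natom∈ []                  ((_ , pos _) ∷ _)   (here ())
  natom∈ []                  ((_ , natom _) ∷ _) (here refl) = onʳ (here refl)
  natom∈ (_ ∷ Γ)             Δ                   (there i) with onʳ j ← natom∈ Γ Δ i = onʳ j
  natom∈ ((_ , neg _) ∷ _)   _                   (here ())
  natom∈ ((_ , patom _) ∷ _) _                   (here ())

  natom∈-inʳ : ∀ Γ (i : (z , natom n) ∈ Δ) → natom∈ Γ Δ (inʳ Γ i) ≡ onʳ i
  natom∈-inʳ []      (here refl) = refl
  natom∈-inʳ []      (there i)   rewrite natom∈-inʳ [] i = refl
  natom∈-inʳ (_ ∷ Γ) i           rewrite natom∈-inʳ Γ i = refl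

  -- The position, not the formula, reveals what was negated: `rfocus 𝟙` and `lfocus bot` coincide,
  -- for instance. The view therefore returns the classical occurrence.
  data Neg∈ Γ Δ {z} : ∀ {N} → (z , neg N) ∈ join Γ Δ → Set where
    onˡ : ∀ {N} (i : (z , neg N) ∈ Γ) → Neg∈ Γ Δ (inˡ i)
    onʳ : ∀ {P} (i : (z , pos P) ∈ Δ) → Neg∈ Γ Δ (inʳ Γ i)

  neg∈ : ∀ Γ Δ {z N} (i : (z , neg N) ∈ join Γ Δ) → Neg∈ Γ Δ i
  neg∈ []                  (_ ∷ Δ)             (there i) with neg∈ [] Δ i
  ... | onʳ j = onʳ (there j)
  neg∈ []                  ((_ , pos _) ∷ _)   (here refl) = onʳ (here refl)
  neg∈ []                  ((_ , natom _) ∷ _) (here ())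
  neg∈ (_ ∷ Γ)             Δ                   (there i) with neg∈ Γ Δ i
  ... | onˡ j = onˡ (there j)
  ... | onʳ j = onʳ j
  neg∈ ((_ , neg _) ∷ _)   _                   (here refl) = onˡ (here refl)
  neg∈ ((_ , patom _) ∷ _) _                   (here ())

  neg∈-inˡ : (i : (z , neg N) ∈ Γ) → neg∈ Γ Δ (inˡ i) ≡ onˡ i
  neg∈-inˡ         (here refl) = refl
  neg∈-inˡ {Δ = Δ} (there i)   rewrite neg∈-inˡ {Δ = Δ} i = refl

  neg∈-inʳ : ∀ Γ (i : (z , pos P) ∈ Δ) → neg∈ Γ Δ (inʳ Γ i) ≡ onʳ i
  neg∈-inʳ []      (here refl) = refl
  neg∈-inʳ []      (there i)   rewrite neg∈-inʳ [] i = refl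
  neg∈-inʳ (_ ∷ Γ) i           rewrite neg∈-inʳ Γ i = refl

  -- Splits of a joined context.

  joinSplit : Split Γ Γ₁ Γ₂ → Split Δ Δ₁ Δ₂ → Split (join Γ Δ) (join Γ₁ Δ₁) (join Γ₂ Δ₂)
  joinSplit []          []          = []
  joinSplit []          (share u t) = share u (joinSplit [] t)
  joinSplit []          (fst ¬u t)  = fst ¬u (joinSplit [] t)
  joinSplit []          (snd ¬u t)  = snd ¬u (joinSplit [] t)
  joinSplit (share u s) t           = share u (joinSplit s t)
  joinSplit (fst ¬u s)  t           = fst ¬u (joinSplit s t)
  joinSplit (snd ¬u s)  t           = snd ¬u (joinSplit s t)

  data SplitJoin Γ Δ : Split (join Γ Δ) Θ₁ Θ₂ → Set where
    joined : (s : Split Γ Γ₁ Γ₂) (t : Split Δ Δ₁ Δ₂) → SplitJoin Γ Δ (joinSplit s t)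

  -- A split treats each formula separately and depends only on its zone, which the translation
  -- keeps.
  splitJoin : ∀ Γ Δ (s : Split (join Γ Δ) Θ₁ Θ₂) → SplitJoin Γ Δ s
  splitJoin []      []      []          = joined [] []
  splitJoin []      (_ ∷ Δ) (share u s) with joined [] t ← splitJoin [] Δ s = joined [] (share u t)
  splitJoin []      (_ ∷ Δ) (fst ¬u s)  with joined [] t ← splitJoin [] Δ s = joined [] (fst ¬u t)
  splitJoin []      (_ ∷ Δ) (snd ¬u s)  with joined [] t ← splitJoin [] Δ s = joined [] (snd ¬u t)
  splitJoin (_ ∷ Γ) Δ       (share u s) with joined s t ← splitJoin Γ Δ s = joined (share u s) t
  splitJoin (_ ∷ Γ) Δ       (fst ¬u s)  with joined s t ← splitJoin Γ Δ s = joined (fst ¬u s) t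
  splitJoin (_ ∷ Γ) Δ       (snd ¬u s)  with joined s t ← splitJoin Γ Δ s = joined (snd ¬u s) t

  splitJoin-joinSplit : (s : Split Γ Γ₁ Γ₂) (t : Split Δ Δ₁ Δ₂) →
                        splitJoin Γ Δ (joinSplit s t) ≡ joined s t
  splitJoin-joinSplit []          []          = refl
  splitJoin-joinSplit []          (share _ t) rewrite splitJoin-joinSplit [] t = refl
  splitJoin-joinSplit []          (fst _ t)   rewrite splitJoin-joinSplit [] t = refl
  splitJoin-joinSplit []          (snd _ t)   rewrite splitJoin-joinSplit [] t = refl
  splitJoin-joinSplit (share _ s) t           rewrite splitJoin-joinSplit s t = refl
  splitJoin-joinSplit (fst _ s)   t           rewrite splitJoin-joinSplit s t = refl
  splitJoin-joinSplit (snd _ s)   t           rewrite splitJoin-joinSplit s t = refl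

  -- Left focus on a negation.

  unrestricted : I.LCtx → I.LCtx
  unrestricted = filter (U? ∘ proj₁)

  unr-unrestricted : ∀ Θ → Unr (unrestricted Θ)
  unr-unrestricted = all-filter (U? ∘ proj₁)

  -- The split used by `⊸L` on a negation: the premise for k is initial and can take only the
  -- unrestricted part, so everything goes to the other premise.
  sharing : ∀ Θ → Split Θ Θ (unrestricted Θ)
  sharing []            = []
  sharing ((z , _) ∷ Θ) with U? z
  ... | yes u = share u (sharing Θ)
  ... | no ¬u = fst ¬u (sharing Θ)

  sharing-unique : (s : Split Θ Θ₁ Θ₂) → .(Unr Θ₂) → SameSplit 𝒮 s (sharing Θ)
  sharing-unique {Θ = Θ} s a = same-split 𝒮 s (sharing Θ) a (unr-unrestricted Θ)

  -- The equation is an argument because the context left by a restricted decision equals a `join`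
  -- only propositionally. `X` is arbitrary so that the map applies both to erased and to full
  -- phases.
  negate : ∀ {X} → Θ ≡ Θ₁ → I.FocusPhase X (Θ₁ ⊢[ R ]) →
           I.FocusPhase X (Θ [ R ⊸ atom (inj₂ tt) ]⊢ goal)
  negate {Θ = Θ} refl d = I.⊸L (sharing Θ) d (I.initL (unr-unrestricted Θ))

  unsplit : ∀ {X} {s : Split Θ Θ₁ Θ₂} {t : Split Θ Θ₁′ Θ₂′} → SameSplit 𝒮 s t →
            I.FocusPhase X (Θ₁ ⊢[ R ]) → I.FocusPhase X (Θ₁′ ⊢[ R ])
  unsplit same d = d

  -- Focus on k can only end with `initL`, whose context is unrestricted. Uniqueness of the split
  -- then makes the first half all of `Θ`.
  unnegate : ∀ {X} → Θ ≡ Θ₁ → I.FocusPhase X (Θ [ R ⊸ atom (inj₂ tt) ]⊢ goal) →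
             I.FocusPhase X (Θ₁ ⊢[ R ])
  unnegate refl (I.⊸L s d (I.initL a)) = unsplit (sharing-unique s a) d

  unnegate-negate : ∀ {X} (eq : Θ ≡ Θ₁) (d : I.FocusPhase X (Θ₁ ⊢[ R ])) →
                    unnegate eq (negate eq d) ≡ d
  unnegate-negate {Θ = Θ} refl d
    with same ← sharing-unique (sharing Θ) (unr-unrestricted Θ) = refl

  negate-unnegate : ∀ {X} (eq : Θ ≡ Θ₁) (d : I.FocusPhase X (Θ [ R ⊸ atom (inj₂ tt) ]⊢ goal)) →
                    negate eq (unnegate eq d) ≡ d
  negate-unnegate refl (I.⊸L s d (I.initL a)) with same ← sharing-unique s a = refl

  -- Bijection between erased focus phases.

  -- Synthetic derivations are equal when their erasures are, so the bijection is first built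
  -- between erased phases, where nothing is recorded above an active sequent.
  toR : C.FocusPhase C.Erased (Γ ⊢[ P ] Δ) → I.FocusPhase I.Erased (join Γ Δ ⊢[ rfocus P ])
  toR (C.initR i a b) = I.initR (inˡ i) (subst Unr (sym (─-inˡ i)) (join⁺ a b))
  toR (C.⊗R s t d e)  = I.⊗R (joinSplit s t) (toR d) (toR e)
  toR (C.𝟙R a b)      = I.𝟙R (join⁺ a b)
  toR (C.⊕R₁ d)       = I.⊕R₁ (toR d)
  toR (C.⊕R₂ d)       = I.⊕R₂ (toR d)
  toR (C.!R a b _)    = I.!R (join⁺ a b) tt

  toL : C.FocusPhase C.Erased (Γ [ N ]⊢ Δ) → I.FocusPhase I.Erased (join Γ Δ ⊢[ lfocus N ])
  toL {Γ} (C.initL i a b) = I.initR (inʳ Γ i) (subst Unr (sym (─-inʳ Γ i)) (join⁺ a b))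
  toL (C.&L₁ d)       = I.⊕R₁ (toL d)
  toL (C.&L₂ d)       = I.⊕R₂ (toL d)
  toL (C.⅋L s t d e)  = I.⊗R (joinSplit s t) (toL d) (toL e)
  toL (C.botL a b)    = I.𝟙R (join⁺ a b)
  toL (C.⊸L s t d e)  = I.⊗R (joinSplit s t) (toR d) (toL e)
  toL (C.?L a b _)    = I.!R (join⁺ a b) tt

  -- The classical data are explicit because their translations do not determine them. Matching on
  -- `P` exposes the outermost connective of `rfocus P`, hence the rules that can apply.
  fromR : ∀ Γ P Δ → I.FocusPhase I.Erased (join Γ Δ ⊢[ rfocus P ]) →
          C.FocusPhase C.Erased (Γ ⊢[ P ] Δ)
  fromR Γ (atom p) Δ (I.initR i a) with patom∈ Γ Δ i
  ... | onˡ j = C.initR j (joinˡ⁻ (Γ ─ j) (subst Unr (─-inˡ j) a))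
                          (joinʳ⁻ (Γ ─ j) Δ (subst Unr (─-inˡ j) a))
  fromR Γ (P ⊗ Q) Δ (I.⊗R s d e) with splitJoin Γ Δ s
  ... | joined s t = C.⊗R s t (fromR _ P _ d) (fromR _ Q _ e)
  fromR Γ 𝟙 Δ (I.𝟙R a)          = C.𝟙R (joinˡ⁻ Γ a) (joinʳ⁻ Γ Δ a)
  fromR Γ (P ⊕ Q) Δ (I.⊕R₁ d)   = C.⊕R₁ (fromR Γ P Δ d)
  fromR Γ (P ⊕ Q) Δ (I.⊕R₂ d)   = C.⊕R₂ (fromR Γ Q Δ d)
  fromR Γ (![ _ ] _) Δ (I.!R a _) = C.!R (joinˡ⁻ Γ a) (joinʳ⁻ Γ Δ a) tt

  fromL : ∀ Γ N Δ → I.FocusPhase I.Erased (join Γ Δ ⊢[ lfocus N ]) →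
          C.FocusPhase C.Erased (Γ [ N ]⊢ Δ)
  fromL Γ (atom n) Δ (I.initR i a) with natom∈ Γ Δ i
  ... | onʳ j = C.initL j (joinˡ⁻ Γ (subst Unr (─-inʳ Γ j) a))
                          (joinʳ⁻ Γ (Δ ─ j) (subst Unr (─-inʳ Γ j) a))
  fromL Γ (N & M) Δ (I.⊕R₁ d)   = C.&L₁ (fromL Γ N Δ d)
  fromL Γ (N & M) Δ (I.⊕R₂ d)   = C.&L₂ (fromL Γ M Δ d)
  fromL Γ (N ⅋ M) Δ (I.⊗R s d e) with splitJoin Γ Δ s
  ... | joined s t = C.⅋L s t (fromL _ N _ d) (fromL _ M _ e)
  fromL Γ bot Δ (I.𝟙R a)        = C.botL (joinˡ⁻ Γ a) (joinʳ⁻ Γ Δ a)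
  fromL Γ (P ⊸ N) Δ (I.⊗R s d e) with splitJoin Γ Δ s
  ... | joined s t = C.⊸L s t (fromR _ P _ d) (fromL _ N _ e)
  fromL Γ (?[ _ ] _) Δ (I.!R a _) = C.?L (joinˡ⁻ Γ a) (joinʳ⁻ Γ Δ a) tt

  fromR-toR : (d : C.FocusPhase C.Erased (Γ ⊢[ P ] Δ)) → fromR Γ P Δ (toR d) ≡ d
  fromR-toR {Δ = Δ} (C.initR i _ _) rewrite patom∈-inˡ {Δ = Δ} i = refl
  fromR-toR (C.⊗R s t d e) rewrite splitJoin-joinSplit s t =
    cong₂ (C.⊗R s t) (fromR-toR d) (fromR-toR e)
  fromR-toR (C.𝟙R _ _)     = refl
  fromR-toR (C.⊕R₁ d)      = cong C.⊕R₁ (fromR-toR d)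
  fromR-toR (C.⊕R₂ d)      = cong C.⊕R₂ (fromR-toR d)
  fromR-toR (C.!R _ _ _)   = refl

  fromL-toL : (d : C.FocusPhase C.Erased (Γ [ N ]⊢ Δ)) → fromL Γ N Δ (toL d) ≡ d
  fromL-toL {Γ} (C.initL i _ _) rewrite natom∈-inʳ Γ i = refl
  fromL-toL (C.&L₁ d)      = cong C.&L₁ (fromL-toL d)
  fromL-toL (C.&L₂ d)      = cong C.&L₂ (fromL-toL d)
  fromL-toL (C.⅋L s t d e) rewrite splitJoin-joinSplit s t =
    cong₂ (C.⅋L s t) (fromL-toL d) (fromL-toL e)
  fromL-toL (C.botL _ _)   = refl
  fromL-toL (C.⊸L s t d e) rewrite splitJoin-joinSplit s t =
    cong₂ (C.⊸L s t) (fromR-toR d) (fromL-toL e)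
  fromL-toL (C.?L _ _ _)   = refl

  toR-fromR : ∀ Γ P Δ (d : I.FocusPhase I.Erased (join Γ Δ ⊢[ rfocus P ])) →
              toR (fromR Γ P Δ d) ≡ d
  toR-fromR Γ (atom p) Δ (I.initR i _) with patom∈ Γ Δ i
  ... | onˡ _ = refl
  toR-fromR Γ (P ⊗ Q) Δ (I.⊗R s d e) with splitJoin Γ Δ s
  ... | joined s t = cong₂ (I.⊗R (joinSplit s t)) (toR-fromR _ P _ d) (toR-fromR _ Q _ e)
  toR-fromR Γ 𝟙 Δ (I.𝟙R _)            = refl
  toR-fromR Γ (P ⊕ Q) Δ (I.⊕R₁ d)     = cong I.⊕R₁ (toR-fromR Γ P Δ d)
  toR-fromR Γ (P ⊕ Q) Δ (I.⊕R₂ d)     = cong I.⊕R₂ (toR-fromR Γ Q Δ d)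
  toR-fromR Γ (![ _ ] _) Δ (I.!R _ _) = refl

  toL-fromL : ∀ Γ N Δ (d : I.FocusPhase I.Erased (join Γ Δ ⊢[ lfocus N ])) →
              toL (fromL Γ N Δ d) ≡ d
  toL-fromL Γ (atom n) Δ (I.initR i _) with natom∈ Γ Δ i
  ... | onʳ _ = refl
  toL-fromL Γ (N & M) Δ (I.⊕R₁ d)     = cong I.⊕R₁ (toL-fromL Γ N Δ d)
  toL-fromL Γ (N & M) Δ (I.⊕R₂ d)     = cong I.⊕R₂ (toL-fromL Γ M Δ d)
  toL-fromL Γ (N ⅋ M) Δ (I.⊗R s d e) with splitJoin Γ Δ s
  ... | joined s t = cong₂ (I.⊗R (joinSplit s t)) (toL-fromL _ N _ d) (toL-fromL _ M _ e)
  toL-fromL Γ bot Δ (I.𝟙R _)          = refl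
  toL-fromL Γ (P ⊸ N) Δ (I.⊗R s d e) with splitJoin Γ Δ s
  ... | joined s t = cong₂ (I.⊗R (joinSplit s t)) (toR-fromR _ P _ d) (toL-fromL _ N _ e)
  toL-fromL Γ (?[ _ ] _) Δ (I.!R _ _) = refl

  -- Bijection between erased decisions.

  to : ∀ {S} → C.Decision C.Erased S → I.Decision I.Erased (encode S)
  to {Γ C.⊢ Δ} (C.decideRʳ i ¬u d) = I.decideLʳ (inʳ Γ i) ¬u (negate (─-inʳ Γ i) (toR d))
  to {Γ C.⊢ Δ} (C.decideRᵘ i u d)  = I.decideLᵘ (inʳ Γ i) u (negate refl (toR d))
  to {Γ C.⊢ Δ} (C.decideLʳ i ¬u d) = I.decideLʳ (inˡ i) ¬u (negate (─-inˡ i) (toL d))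
  to {Γ C.⊢ Δ} (C.decideLᵘ i u d)  = I.decideLᵘ (inˡ i) u (negate refl (toL d))

  from : ∀ S → I.Decision I.Erased (encode S) → C.Decision C.Erased S
  from (Γ C.⊢ Δ) (I.decideLʳ i ¬u d) with neg∈ Γ Δ i
  ... | onˡ {N} j = C.decideLʳ j ¬u (fromL (Γ ─ j) N Δ (unnegate (─-inˡ j) d))
  ... | onʳ {P} j = C.decideRʳ j ¬u (fromR Γ P (Δ ─ j) (unnegate (─-inʳ Γ j) d))
  from (Γ C.⊢ Δ) (I.decideLᵘ i u d) with neg∈ Γ Δ i
  ... | onˡ {N} j = C.decideLᵘ j u (fromL Γ N Δ (unnegate refl d))
  ... | onʳ {P} j = C.decideRᵘ j u (fromR Γ P Δ (unnegate refl d))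

  fromR-unnegate-negate-toR : (eq : Θ ≡ join Γ Δ) (d : C.FocusPhase C.Erased (Γ ⊢[ P ] Δ)) →
                              fromR Γ P Δ (unnegate eq (negate eq (toR d))) ≡ d
  fromR-unnegate-negate-toR eq d =
    trans (cong (fromR _ _ _) (unnegate-negate eq (toR d))) (fromR-toR d)

  fromL-unnegate-negate-toL : (eq : Θ ≡ join Γ Δ) (d : C.FocusPhase C.Erased (Γ [ N ]⊢ Δ)) →
                              fromL Γ N Δ (unnegate eq (negate eq (toL d))) ≡ d
  fromL-unnegate-negate-toL eq d =
    trans (cong (fromL _ _ _) (unnegate-negate eq (toL d))) (fromL-toL d)

  from-to : ∀ {S} (d : C.Decision C.Erased S) → from S (to d) ≡ d
  from-to {Γ C.⊢ Δ} (C.decideRʳ i ¬u d) rewrite neg∈-inʳ Γ i =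
    cong (C.decideRʳ i ¬u) (fromR-unnegate-negate-toR (─-inʳ Γ i) d)
  from-to {Γ C.⊢ Δ} (C.decideRᵘ i u d) rewrite neg∈-inʳ Γ i =
    cong (C.decideRᵘ i u) (fromR-unnegate-negate-toR refl d)
  from-to {Γ C.⊢ Δ} (C.decideLʳ i ¬u d) rewrite neg∈-inˡ {Δ = Δ} i =
    cong (C.decideLʳ i ¬u) (fromL-unnegate-negate-toL (─-inˡ i) d)
  from-to {Γ C.⊢ Δ} (C.decideLᵘ i u d) rewrite neg∈-inˡ {Δ = Δ} i =
    cong (C.decideLᵘ i u) (fromL-unnegate-negate-toL refl d)

  negate-toR-fromR-unnegate : ∀ Γ P Δ (eq : Θ ≡ join Γ Δ)
    (d : I.FocusPhase I.Erased (Θ [ rfocus P ⊸ atom (inj₂ tt) ]⊢ goal)) →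
    negate eq (toR (fromR Γ P Δ (unnegate eq d))) ≡ d
  negate-toR-fromR-unnegate Γ P Δ eq d =
    trans (cong (negate eq) (toR-fromR Γ P Δ (unnegate eq d))) (negate-unnegate eq d)

  negate-toL-fromL-unnegate : ∀ Γ N Δ (eq : Θ ≡ join Γ Δ)
    (d : I.FocusPhase I.Erased (Θ [ lfocus N ⊸ atom (inj₂ tt) ]⊢ goal)) →
    negate eq (toL (fromL Γ N Δ (unnegate eq d))) ≡ d
  negate-toL-fromL-unnegate Γ N Δ eq d =
    trans (cong (negate eq) (toL-fromL Γ N Δ (unnegate eq d))) (negate-unnegate eq d)

  to-from : ∀ S (d : I.Decision I.Erased (encode S)) → to (from S d) ≡ d
  to-from (Γ C.⊢ Δ) (I.decideLʳ i ¬u d) with neg∈ Γ Δ i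
  ... | onˡ {N} j = cong (I.decideLʳ _ ¬u) (negate-toL-fromL-unnegate _ N Δ (─-inˡ j) d)
  ... | onʳ {P} j = cong (I.decideLʳ _ ¬u) (negate-toR-fromR-unnegate Γ P _ (─-inʳ Γ j) d)
  to-from (Γ C.⊢ Δ) (I.decideLᵘ i u d) with neg∈ Γ Δ i
  ... | onˡ {N} j = cong (I.decideLᵘ _ u) (negate-toL-fromL-unnegate Γ N Δ refl d)
  ... | onʳ {P} j = cong (I.decideLᵘ _ u) (negate-toR-fromR-unnegate Γ P Δ refl d)

  -- Existence of active phases.

  -- The continuation treats the remaining active formulas. It must accept every `Γ`, since
  -- decomposing `P^` adds formulas to the left passive context, differently in each branch.
  canonL : ∀ P^ → (∀ Γ → C.ActivePhase (Γ ⨾ Ω ⊢ Ξ ⨾ Δ)) → ∀ Γ → C.ActivePhase (Γ ⨾ P^ ∷ Ω ⊢ Ξ ⨾ Δ)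
  canonL (natom n)         κ Γ = C.natomL (here refl) (κ _)
  canonL (pos (atom p))    κ Γ = C.patomL (here refl) (κ _)
  canonL (pos (P ⊗ Q))     κ Γ = C.⊗L (here refl) (canonL (pos P) (canonL (pos Q) κ) Γ)
  canonL (pos 𝟙)           κ Γ = C.𝟙L (here refl) (κ Γ)
  canonL (pos (P ⊕ Q))     κ Γ = C.⊕L (here refl) (canonL (pos P) κ Γ) (canonL (pos Q) κ Γ)
  canonL (pos 𝟘)           κ Γ = C.𝟘L (here refl)
  canonL (pos (![ z ] N))  κ Γ = C.!L (here refl) (κ _)

  canonR : ∀ N^ → (∀ Γ Δ → C.ActivePhase (Γ ⨾ Ω ⊢ Ξ ⨾ Δ)) → ∀ Γ Δ → C.ActivePhase (Γ ⨾ Ω ⊢ N^ ∷ Ξ ⨾ Δ)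
  canonR (patom p)         κ Γ Δ = C.patomR (here refl) (κ _ _)
  canonR (neg (atom n))    κ Γ Δ = C.natomR (here refl) (κ _ _)
  canonR (neg (N & M))     κ Γ Δ = C.&R (here refl) (canonR (neg N) κ Γ Δ) (canonR (neg M) κ Γ Δ)
  canonR (neg top)         κ Γ Δ = C.topR (here refl)
  canonR (neg (N ⅋ M))     κ Γ Δ = C.⅋R (here refl) (canonR (neg N) (canonR (neg M) κ) Γ Δ)
  canonR (neg bot)         κ Γ Δ = C.botR (here refl) (κ Γ Δ)
  -- `N` is decomposed first, while `P` waits at the head of the left active context; the
  -- continuation for `N` then decomposes `P`.
  canonR (neg (P ⊸ N))     κ Γ Δ =
    C.⊸R (here refl) (canonR (neg N) (λ Γ Δ → canonL (pos P) (λ Γ → κ Γ Δ) Γ) Γ Δ)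
  canonR (neg (?[ z ] P))  κ Γ Δ = C.?R (here refl) (κ _ _)

  -- Erasure is onto, because the active sequent above an erased `!R` or `?L` can always be
  -- decomposed completely.
  fillFocus : ∀ {S} (d : C.FocusPhase C.Erased S) →
              ∃ λ (e : C.FocusPhase C.ActivePhase S) → C.eraseFocus e ≡ d
  fillFocus (C.initR i a b) = C.initR i a b , refl
  fillFocus (C.⊗R s t d e) with d′ , refl ← fillFocus d | e′ , refl ← fillFocus e =
    C.⊗R s t d′ e′ , refl
  fillFocus (C.𝟙R a b)      = C.𝟙R a b , refl
  fillFocus (C.⊕R₁ d) with d′ , refl ← fillFocus d = C.⊕R₁ d′ , refl
  fillFocus (C.⊕R₂ d) with d′ , refl ← fillFocus d = C.⊕R₂ d′ , refl
  fillFocus (C.!R a b _)    = C.!R a b (canonR _ (λ _ _ → C.open-leaf) _ _) , refl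
  fillFocus (C.initL i a b) = C.initL i a b , refl
  fillFocus (C.&L₁ d) with d′ , refl ← fillFocus d = C.&L₁ d′ , refl
  fillFocus (C.&L₂ d) with d′ , refl ← fillFocus d = C.&L₂ d′ , refl
  fillFocus (C.⅋L s t d e) with d′ , refl ← fillFocus d | e′ , refl ← fillFocus e =
    C.⅋L s t d′ e′ , refl
  fillFocus (C.botL a b)    = C.botL a b , refl
  fillFocus (C.⊸L s t d e) with d′ , refl ← fillFocus d | e′ , refl ← fillFocus e =
    C.⊸L s t d′ e′ , refl
  fillFocus (C.?L a b _)    = C.?L a b (canonL _ (λ _ → C.open-leaf) _) , refl

  fill : ∀ {S} (d : C.Decision C.Erased S) → ∃ λ (e : C.SyntheticDerivation S) → C.erase e ≡ d
  fill (C.decideRʳ i a d) with d′ , refl ← fillFocus d = C.decideRʳ i a d′ , refl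
  fill (C.decideRᵘ i a d) with d′ , refl ← fillFocus d = C.decideRᵘ i a d′ , refl
  fill (C.decideLʳ i a d) with d′ , refl ← fillFocus d = C.decideLʳ i a d′ , refl
  fill (C.decideLᵘ i a d) with d′ , refl ← fillFocus d = C.decideLᵘ i a d′ , refl

  -- Simulation of active phases.

  open Calculus (ISL 𝒮 B⁺ B⁻) using (_↭ₙ_; neutralSetoid)
  module ↭ₙ = SetoidPermutation neutralSetoid
  module ↭ₙₚ = SetoidPermutationₚ neutralSetoid

  encode-++⁺ : ∀ {Ls Ms} Ss Ts → Ls ↭ₙ map encode Ss → Ms ↭ₙ map encode Ts →
               Ls ++ Ms ↭ₙ map encode (Ss ++ Ts)
  encode-++⁺ Ss Ts ρ σ =
    ↭ₙ.↭-trans (↭ₙₚ.++⁺ ρ σ) (↭ₙ.↭-reflexive (sym (map-++ encode Ss Ts)))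

  actives : List Pos^ᶜ → List Neg^ᶜ → List Pos^ⁱ
  actives Ω Ξ = map (pos ∘ lactive) Ω ++ map (pos ∘ ractive) Ξ

  extractˡ : (i : P^ ∈ Ω) → Φ ↭ actives Ω Ξ →
             Σ (pos (lactive P^) ∈ Φ) λ j → (Φ ─ j) ↭ actives (Ω ─ i) Ξ
  extractˡ i φ = extract-↭ (↭-trans φ (++⁺ʳ _ (map⁺ (pos ∘ lactive) (extract i))))

  insertʳ : ∀ Ω → Φ ↭ actives Ω Ξ → pos (ractive N^) ∷ Φ ↭ actives Ω (N^ ∷ Ξ)
  insertʳ Ω φ = ↭-trans (prep _ φ) (↭-sym (shift _ (map (pos ∘ lactive) Ω) _))

  extractʳ : ∀ Ω (i : N^ ∈ Ξ) → Φ ↭ actives Ω Ξ →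
             Σ (pos (ractive N^) ∈ Φ) λ j → (Φ ─ j) ↭ actives Ω (Ξ ─ i)
  extractʳ Ω i φ = extract-↭
    (↭-trans φ (↭-trans (++⁺ˡ (map (pos ∘ lactive) Ω) (map⁺ (pos ∘ ractive) (extract i)))
                        (shift _ (map (pos ∘ lactive) Ω) _)))

  join-∷ʳ : ∀ Γ → Θ ↭ join Γ Δ → (z , rpassive P^) ∷ Θ ↭ join Γ ((z , P^) ∷ Δ)
  join-∷ʳ Γ θ = ↭-trans (prep _ θ) (↭-sym (shift _ (map (map₂ lpassive) Γ) _))

  Simulates : I.Active → List C.Neutral → Set
  Simulates S Ss = ∃ λ (e : I.ActivePhase S) → I.leaves e ↭ₙ map encode Ss

  -- Each classical active rule is matched by one left active rule. Contexts agree only up to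
  -- permutation: a new right formula enters in the middle of `join` or `actives`, but at the front
  -- of the intuitionistic context. Neutral sequents are compared up to permutation, so this
  -- suffices at the leaves.
  simulate : (d : C.ActivePhase (Γ ⨾ Ω ⊢ Ξ ⨾ Δ)) → Θ ↭ join Γ Δ → Φ ↭ actives Ω Ξ →
             Simulates (Θ ⨾ Φ ⊢ passive goal) (C.leaves d)
  simulate C.open-leaf θ φ with refl ← ↭-empty-inv φ =
    I.open-leaf , ↭ₙ.prep (θ , ↭-refl) ↭ₙ.↭-refl
  simulate {Γ = Γ} {Ω = Ω} (C.patomR i d) θ φ =
    let j , φ′ = extractʳ Ω i φ; e , ρ = simulate d (join-∷ʳ Γ θ) φ′ in I.!L j e , ρ
  simulate {Γ = Γ} {Ω = Ω} (C.natomR i d) θ φ =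
    let j , φ′ = extractʳ Ω i φ; e , ρ = simulate d (join-∷ʳ Γ θ) φ′ in I.patomL j e , ρ
  simulate {Ω = Ω} (C.&R i d d′) θ φ =
    let j , φ′  = extractʳ Ω i φ
        e , ρ   = simulate d θ (insertʳ Ω φ′)
        e′ , ρ′ = simulate d′ θ (insertʳ Ω φ′)
    in I.⊕L j e e′ , encode-++⁺ (C.leaves d) _ ρ ρ′
  simulate {Ω = Ω} (C.topR i) θ φ =
    let j , _ = extractʳ Ω i φ in I.𝟘L j , ↭ₙ.↭-refl
  simulate {Ω = Ω} (C.⅋R i d) θ φ =
    let j , φ′ = extractʳ Ω i φ; e , ρ = simulate d θ (insertʳ Ω (insertʳ Ω φ′)) in I.⊗L j e , ρ
  simulate {Ω = Ω} (C.botR i d) θ φ =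
    let j , φ′ = extractʳ Ω i φ; e , ρ = simulate d θ φ′ in I.𝟙L j e , ρ
  simulate {Ω = Ω} (C.⊸R i d) θ φ =
    let j , φ′ = extractʳ Ω i φ; e , ρ = simulate d θ (prep _ (insertʳ Ω φ′)) in I.⊗L j e , ρ
  simulate {Γ = Γ} {Ω = Ω} (C.?R i d) θ φ =
    let j , φ′ = extractʳ Ω i φ; e , ρ = simulate d (join-∷ʳ Γ θ) φ′ in I.!L j e , ρ
  simulate (C.patomL i d) θ φ =
    let j , φ′ = extractˡ i φ; e , ρ = simulate d (prep _ θ) φ′ in I.patomL j e , ρ
  simulate (C.natomL i d) θ φ =
    let j , φ′ = extractˡ i φ; e , ρ = simulate d (prep _ θ) φ′ in I.!L j e , ρ
  simulate (C.⊗L i d) θ φ =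
    let j , φ′ = extractˡ i φ; e , ρ = simulate d θ (prep _ (prep _ φ′)) in I.⊗L j e , ρ
  simulate (C.𝟙L i d) θ φ =
    let j , φ′ = extractˡ i φ; e , ρ = simulate d θ φ′ in I.𝟙L j e , ρ
  simulate (C.⊕L i d d′) θ φ =
    let j , φ′  = extractˡ i φ
        e , ρ   = simulate d θ (prep _ φ′)
        e′ , ρ′ = simulate d′ θ (prep _ φ′)
    in I.⊕L j e e′ , encode-++⁺ (C.leaves d) _ ρ ρ′
  simulate (C.𝟘L i) θ φ =
    let j , _ = extractˡ i φ in I.𝟘L j , ↭ₙ.↭-refl
  simulate (C.!L i d) θ φ =
    let j , φ′ = extractˡ i φ; e , ρ = simulate d (prep _ θ) φ′ in I.!L j e , ρ

  -- Simulation of focus phases and decisions.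

  simulateR : (d : C.FocusPhase C.ActivePhase (Γ ⊢[ P ] Δ)) →
              ∃ λ (e : I.FocusPhase I.ActivePhase (join Γ Δ ⊢[ rfocus P ])) →
                I.eraseFocus e ≡ toR (C.eraseFocus d) × I.focusLeaves e ↭ₙ map encode (C.focusLeaves d)
  simulateR (C.initR i _ _) = I.initR (inˡ i) _ , refl , ↭ₙ.↭-refl
  simulateR (C.⊗R s t d d′) =
    let e , eq , ρ = simulateR d; e′ , eq′ , ρ′ = simulateR d′ in
    I.⊗R (joinSplit s t) e e′ , cong₂ (I.⊗R _) eq eq′ , encode-++⁺ (C.focusLeaves d) _ ρ ρ′
  simulateR (C.𝟙R _ _) = I.𝟙R _ , refl , ↭ₙ.↭-refl
  simulateR (C.⊕R₁ d) = let e , eq , ρ = simulateR d in I.⊕R₁ e , cong I.⊕R₁ eq , ρ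
  simulateR (C.⊕R₂ d) = let e , eq , ρ = simulateR d in I.⊕R₂ e , cong I.⊕R₂ eq , ρ
  simulateR (C.!R a b d) =
    let e , ρ = simulate d ↭-refl ↭-refl in
    -- `⊸R` and `natomR` have no classical counterpart; they only open the negation below the
    -- simulated active phase.
    I.!R (join⁺ a b) (I.⊸R (I.natomR e)) , refl , ρ

  simulateL : (d : C.FocusPhase C.ActivePhase (Γ [ N ]⊢ Δ)) →
              ∃ λ (e : I.FocusPhase I.ActivePhase (join Γ Δ ⊢[ lfocus N ])) →
                I.eraseFocus e ≡ toL (C.eraseFocus d) × I.focusLeaves e ↭ₙ map encode (C.focusLeaves d)
  simulateL {Γ} (C.initL i _ _) = I.initR (inʳ Γ i) _ , refl , ↭ₙ.↭-refl
  simulateL (C.&L₁ d) = let e , eq , ρ = simulateL d in I.⊕R₁ e , cong I.⊕R₁ eq , ρ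
  simulateL (C.&L₂ d) = let e , eq , ρ = simulateL d in I.⊕R₂ e , cong I.⊕R₂ eq , ρ
  simulateL (C.⅋L s t d d′) =
    let e , eq , ρ = simulateL d; e′ , eq′ , ρ′ = simulateL d′ in
    I.⊗R (joinSplit s t) e e′ , cong₂ (I.⊗R _) eq eq′ , encode-++⁺ (C.focusLeaves d) _ ρ ρ′
  simulateL (C.botL _ _) = I.𝟙R _ , refl , ↭ₙ.↭-refl
  simulateL (C.⊸L s t d d′) =
    let e , eq , ρ = simulateR d; e′ , eq′ , ρ′ = simulateL d′ in
    I.⊗R (joinSplit s t) e e′ , cong₂ (I.⊗R _) eq eq′ , encode-++⁺ (C.focusLeaves d) _ ρ ρ′
  simulateL (C.?L a b d) =
    let e , ρ = simulate d ↭-refl ↭-refl in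
    I.!R (join⁺ a b) (I.⊸R (I.natomR e)) , refl , ρ

  eraseFocus-negate : (eq : Θ ≡ Θ₁) (d : I.FocusPhase I.ActivePhase (Θ₁ ⊢[ R ])) →
                      I.eraseFocus (negate eq d) ≡ negate eq (I.eraseFocus d)
  eraseFocus-negate refl d = refl

  -- The premise for k is closed by `initL` and contributes no leaf.
  focusLeaves-negate : (eq : Θ ≡ Θ₁) (d : I.FocusPhase I.ActivePhase (Θ₁ ⊢[ R ])) →
                       I.focusLeaves (negate eq d) ≡ I.focusLeaves d
  focusLeaves-negate refl d = ++-identityʳ (I.focusLeaves d)

  simulateNegation : ∀ {Ss} {d : I.FocusPhase I.Erased (Θ₁ ⊢[ R ])} (eq : Θ ≡ Θ₁) →
    (∃ λ (e : I.FocusPhase I.ActivePhase (Θ₁ ⊢[ R ])) →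
       I.eraseFocus e ≡ d × I.focusLeaves e ↭ₙ map encode Ss) →
    ∃ λ (e : I.FocusPhase I.ActivePhase (Θ [ R ⊸ atom (inj₂ tt) ]⊢ goal)) →
      I.eraseFocus e ≡ negate eq d × I.focusLeaves e ↭ₙ map encode Ss
  simulateNegation eq (e , refl , ρ) =
    negate eq e , eraseFocus-negate eq e ,
    ↭ₙ.↭-trans (↭ₙ.↭-reflexive (focusLeaves-negate eq e)) ρ

  -- This lifts `to` to full derivations. The equation on erasures reduces bijectivity to that of
  -- `to`; the permutation is the condition on premises.
  simulateDecision : ∀ {S} (d : C.SyntheticDerivation S) →
    ∃ λ (e : I.SyntheticDerivation (encode S)) →
      I.erase e ≡ to (C.erase d) × I.premises e ↭ₙ map encode (C.premises d)
  simulateDecision {Γ C.⊢ Δ} (C.decideRʳ i ¬u d) =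
    let e , eq , ρ = simulateNegation (─-inʳ Γ i) (simulateR d)
    in I.decideLʳ (inʳ Γ i) ¬u e , cong (I.decideLʳ _ ¬u) eq , ρ
  simulateDecision {Γ C.⊢ Δ} (C.decideRᵘ i u d) =
    let e , eq , ρ = simulateNegation refl (simulateR d)
    in I.decideLᵘ (inʳ Γ i) u e , cong (I.decideLᵘ _ u) eq , ρ
  simulateDecision {Γ C.⊢ Δ} (C.decideLʳ i ¬u d) =
    let e , eq , ρ = simulateNegation (─-inˡ i) (simulateL d)
    in I.decideLʳ (inˡ i) ¬u e , cong (I.decideLʳ _ ¬u) eq , ρ
  simulateDecision {Γ C.⊢ Δ} (C.decideLᵘ i u d) =
    let e , eq , ρ = simulateNegation refl (simulateL d)
    in I.decideLᵘ (inˡ i) u e , cong (I.decideLᵘ _ u) eq , ρ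

  -- The encoding and its focal adequacy.

  encoding : Encoding (CSL 𝒮 A⁺ A⁻) (ISL 𝒮 B⁺ B⁻)
  encoding = record
    { onLeft       = inj₁ ∘ map₂ lpassive
    ; onRight      = inj₁ ∘ map₂ rpassive
    ; extra        = just (inj₂ goal)
    ; encode       = encode
    ; encode-left  = λ { (Γ C.⊢ Δ) →
        ↭-reflexive (sym (cong proj₁ (partitionSums-inj₁ (map₂ lpassive) (map₂ rpassive) Γ Δ))) }
    ; encode-right = λ { (Γ C.⊢ Δ) → ↭-reflexive
        (sym (cong ((goal ∷_) ∘ proj₂) (partitionSums-inj₁ (map₂ lpassive) (map₂ rpassive) Γ Δ))) }
    }

  focallyAdequate : FocallyAdequate encoding
  focallyAdequate S = bijection , λ d → proj₂ (proj₂ (simulateDecision d))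
    where
    erase-simulated : ∀ d → I.erase (proj₁ (simulateDecision d)) ≡ to (C.erase {S} d)
    erase-simulated d = proj₁ (proj₂ (simulateDecision d))

    bijection : Bijection (Calculus.Synthetic (CSL 𝒮 A⁺ A⁻) S)
                          (Calculus.Synthetic (ISL 𝒮 B⁺ B⁻) (encode S))
    bijection = record
      { to        = proj₁ ∘ simulateDecision
      ; cong      = cong-to
      ; bijective = injective , surjective
      }
      where
      cong-to : ∀ {d e} → C.erase {S} d ≡ C.erase e →
                I.erase (proj₁ (simulateDecision d)) ≡ I.erase (proj₁ (simulateDecision e))
      cong-to {d} {e} eq =
        trans (erase-simulated d) (trans (cong to eq) (sym (erase-simulated e)))

      injective : ∀ {d e} →
                  I.erase (proj₁ (simulateDecision d)) ≡ I.erase (proj₁ (simulateDecision e)) →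
                  C.erase {S} d ≡ C.erase e
      injective {d} {e} eq = trans (sym (from-to (C.erase d)))
        (trans (cong (from S) (trans (sym (erase-simulated d)) (trans eq (erase-simulated e))))
               (from-to (C.erase e)))

      surjective : ∀ e → ∃ λ d → ∀ {d′} → C.erase {S} d′ ≡ C.erase d →
                   I.erase (proj₁ (simulateDecision d′)) ≡ I.erase e
      -- The preimage is the erased classical decision obtained from `e`, with canonical active
      -- phases filled in; those of `e` itself are forgotten, as erasure permits.
      surjective e = d , λ {d′} eq →
        trans (erase-simulated d′)
          (trans (cong to (trans eq erase-d)) (to-from S (I.erase e)))
        where
        d       = proj₁ (fill (from S (I.erase e)))
        erase-d = proj₂ (fill (from S (I.erase e)))

-- The three signatures.

𝕦? : Decidable (Signature.U ll)
𝕦? 𝕨 = no λ ()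
𝕦? 𝕦 = yes refl

corollary13 : (A⁺ A⁻ : Set) →
    (Σ Set λ F⁺ → Σ Set λ F⁻ →
    Σ (Encoding (CSL mall A⁺ A⁻) (ISL mall (A⁺ ⊎ F⁺) (A⁻ ⊎ F⁻))) FocallyAdequate)
    × (Σ Set λ F⁺ → Σ Set λ F⁻ →
    Σ (Encoding (CSL ll A⁺ A⁻) (ISL ll (A⁺ ⊎ F⁺) (A⁻ ⊎ F⁻))) FocallyAdequate)
    × (Σ Set λ F⁺ → Σ Set λ F⁻ →
    Σ (Encoding (CSL l A⁺ A⁻) (ISL l (A⁺ ⊎ F⁺) (A⁻ ⊎ F⁻))) FocallyAdequate)
corollary13 A⁺ A⁻ =
    (A⁻ , ⊤ , Mall.encoding , Mall.focallyAdequate)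
  , (A⁻ , ⊤ , Ll.encoding , Ll.focallyAdequate)
  , (A⁻ , ⊤ , L.encoding , L.focallyAdequate)
  where
  module Mall = DoubleNegation mall (λ _ → no λ ()) A⁺ A⁻
  module Ll   = DoubleNegation ll 𝕦? A⁺ A⁻
  module L    = DoubleNegation l (λ _ → yes tt) A⁺ A⁻
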